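{- For odd $k$ let $\mathrm{Ex}^{(k+1)/2}_k=f_{\{(k+1)/2\},k}:\{ -1,1\}^k\to\{0,1\}$ be the function which is $1$ exactly on vectors with exactly $\frac{k+1}2$ coordinates equal to $1$. Then for every odd $k\in\{3,\ldots,51\}$, $$\alpha\big(\mathrm{Ex}^{(k+1)/2}_k\big)=\binom{k}{\frac{k+1}2}\left(\frac{k-1}{2k}(1-p'_k)^{(k+1)/2}(p'_k)^{(k-1)/2}+\frac{k+1}{2k}(1-p'_k)^{(k-1)/2}(p'_k)^{(k+1)/2}\right),$$ where $p'_k=\frac{3k-k^2+\sqrt{4k+k^2-2k^3+k^4}}{4k}$.
   Context: For $\mathbf b\in\{ -1,1\}^k$, $\mathrm{wt}(\mathbf b)$ is the number of coordinates equal to $1$. For nonempty $S\subseteq[k]=\{1,\dots,k\}$, $f_{S,k}:\{ -1,1\}^k\to\{0,1\}$ is given by $f_{S,k}(\mathbf x)=1$ iff $\mathrm{wt}(\mathbf x)\in S$. $\Delta_k$ is the set of symmetric probability distributions $\mathcal D$ on $\{ -1,1\}^k$ (vectors of equal weight are equiprobable). $\mathrm{Bern}(p)$ is the random variable equal to $1$ with probability $p$ and $-1$ with probability $1-p$; $\odot$ is the coordinatewise product. For $\mathcal D\in\Delta_k$ and $p\in[0,1]$ define $$\lambda_S(\mathcal D,p)=\mathbb E_{\mathbf a\sim\mathcal D,\ \mathbf b\sim \mathrm{Bern}(p)^k}[f_{S,k}(\mathbf a\odot\mathbf b)],\quad \mu(\mathcal D)=\mathbb E_{\mathbf b\sim\mathcal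 D}[b_1],\quad \beta_S(\mathcal D)=\sup_{p\in[0,1]}\lambda_S(\mathcal D,p),\quad \gamma_S(\mathcal D)=\lambda_S(\mathcal D,1).$$ The (sketching approximation) ratio of $f_{S,k}$ is $$\alpha(f_{S,k})=\inf_{\mathcal D_N,\mathcal D_Y\in\Delta_k:\ \mu(\mathcal D_N)=\mu(\mathcal D_Y)}\frac{\beta_S(\mathcal D_N)}{\gamma_S(\mathcal D_Y)},$$ where the ratio is $+\infty$ if $\gamma_S(\mathcal D_Y)=0$. -}

module Defs where

open import Algebra.Bundles using (CommutativeRing)
open import Algebra.Structures using (IsCommutativeRing)
import Algebra.Properties.Semiring.Exp as Exp
import Algebra.Properties.Semiring.Mult as Mult
import Algebra.Solver.Ring.NaturalCoefficients.Default as NatSolver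
open import Data.Bool.Base using (if_then_else_; true; false)
open import Data.Fin.Base using (Fin; fromℕ<)
open import Data.List.Base using (List)
open import Data.Nat.Base as ℕ using (ℕ; NonZero)
import Data.Nat.Properties as ℕₚ
open import Data.List.Membership.DecPropositional ℕₚ._≟_ using (_∈?_)
open import Data.Product.Base using (∃; _×_; _,_; proj₁; proj₂)
open import Data.Sign.Base as Sign using (Sign)
import Data.Sign.Properties as Signₚ
open import Data.Sum.Base using (_⊎_; inj₁; inj₂)
open import Data.Vec.Base using (Vec; []; _∷_; zipWith; lookup; count)
open import Function.Base using (flip)
open import Level using (0ℓ)
open import Relation.Binary.Core using (Rel)
open import Relation.Binary.Structures using (IsDecTotalOrder)
open import Relation.Binary.PropositionalEquality.Core using (_≡_)
open import Relation.Nullary using (¬_; does; yes; no; contradiction)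
open import Relation.Nullary.Construct.Add.Supremum using (_⁺; [_]; ⊤⁺)
import Relation.Binary.Construct.Add.Supremum.NonStrict as AddTop
open import Relation.Unary using (Pred)

module _ {A : Set} (_≤_ : Rel A 0ℓ) where

  IsUpperBound : Pred A 0ℓ → A → Set
  IsUpperBound P b = ∀ x → P x → x ≤ b

  IsSupremum : Pred A 0ℓ → A → Set
  IsSupremum P s = IsUpperBound P s × (∀ b → IsUpperBound P b → s ≤ b)

IsInfimum : {A : Set} → Rel A 0ℓ → Pred A 0ℓ → A → Set
IsInfimum _≤_ = IsSupremum (flip _≤_)

-- The standard library has no real numbers.  They are characterised here, up
-- to unique isomorphism, as a Dedekind-complete ordered field; everything
-- below is relative to an arbitrary such field.  The order is decidable and
-- completeness is unrestricted, so this is the classical real line.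
-- The inverse is a total function whose value at 0 is left unspecified.

record CompleteOrderedField : Set₁ where
  infix  8 _⁻¹
  infixl 7 _*_
  infixl 6 _+_
  infix  4 _≈_ _≤_
  field
    Carrier           : Set
    _≈_ _≤_           : Rel Carrier 0ℓ
    _+_ _*_           : Carrier → Carrier → Carrier
    -_ _⁻¹            : Carrier → Carrier
    0# 1#             : Carrier
    isCommutativeRing : IsCommutativeRing _≈_ _+_ _*_ -_ 0# 1#
    isDecTotalOrder   : IsDecTotalOrder _≈_ _≤_
    0≉1               : ¬ (0# ≈ 1#)
    ⁻¹-inverseʳ       : ∀ x → ¬ (x ≈ 0#) → x * x ⁻¹ ≈ 1#
    +-monoˡ-≤         : ∀ z {x y} → x ≤ y → x + z ≤ y + z
    *-nonneg          : ∀ {x y} → 0# ≤ x → 0# ≤ y → 0# ≤ x * y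
    supremum          : (P : Pred Carrier 0ℓ) → ∃ P → ∃ (IsUpperBound _≤_ P) →
                        ∃ (IsSupremum _≤_ P)

  commutativeRing : CommutativeRing 0ℓ 0ℓ
  commutativeRing = record { isCommutativeRing = isCommutativeRing }

  open CommutativeRing commutativeRing public
    using (_-_; ring; semiring; commutativeSemiring; setoid;
           +-cong; +-congˡ; +-congʳ; +-comm; +-assoc; +-identityˡ; +-identityʳ;
           -‿inverseˡ; -‿inverseʳ; *-cong; *-congˡ; *-congʳ; *-comm; *-assoc;
           *-identityˡ; *-identityʳ; distribˡ; distribʳ; zeroˡ; zeroʳ)

  open IsDecTotalOrder isDecTotalOrder public
    using (_≟_; _≤?_; total; antisym; module Eq)
    renaming (refl to ≤-refl; reflexive to ≤-reflexive; trans to ≤-trans)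

module OrderedFieldProperties (R : CompleteOrderedField) where

  open CompleteOrderedField R
  open Eq using (refl; sym; trans)
  open NatSolver commutativeSemiring using (solve; _:+_; _:*_; _:=_)

  ≤-cong : ∀ {a b c d} → a ≈ b → c ≈ d → a ≤ c → b ≤ d
  ≤-cong a≈b c≈d a≤c =
    ≤-trans (≤-reflexive (sym a≈b)) (≤-trans a≤c (≤-reflexive c≈d))

  +-monoʳ-≤ : ∀ z {x y} → x ≤ y → z + x ≤ z + y
  +-monoʳ-≤ z x≤y = ≤-cong (+-comm _ z) (+-comm _ z) (+-monoˡ-≤ z x≤y)

  +-mono-≤ : ∀ {a b c d} → a ≤ b → c ≤ d → a + c ≤ b + d
  +-mono-≤ {b = b} {c} a≤b c≤d = ≤-trans (+-monoˡ-≤ c a≤b) (+-monoʳ-≤ b c≤d)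

  +-nonneg : ∀ {x y} → 0# ≤ x → 0# ≤ y → 0# ≤ x + y
  +-nonneg 0≤x 0≤y = ≤-cong (+-identityˡ 0#) refl (+-mono-≤ 0≤x 0≤y)

  x≤x+y : ∀ x {y} → 0# ≤ y → x ≤ x + y
  x≤x+y x 0≤y = ≤-cong (+-identityʳ x) refl (+-monoʳ-≤ x 0≤y)

  ≤⇒+ : ∀ {x y} → x ≤ y → ∃ λ e → 0# ≤ e × x + e ≈ y
  ≤⇒+ {x} {y} x≤y = y - x , ≤-cong (-‿inverseʳ x) refl (+-monoˡ-≤ (- x) x≤y) ,
    trans (+-comm x (y - x))
      (trans (+-assoc y (- x) x)
        (trans (+-congˡ (-‿inverseˡ x)) (+-identityʳ y)))

  +-cancelʳ-≤ : ∀ z {x y} → x + z ≤ y + z → x ≤ y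
  +-cancelʳ-≤ z p = ≤-cong (strip _) (strip _) (+-monoˡ-≤ (- z) p)
    where
    strip : ∀ x → x + z - z ≈ x
    strip x = trans (+-assoc x z (- z))
                (trans (+-congˡ (-‿inverseʳ z)) (+-identityʳ x))

  *-monoʳ-≤ : ∀ {z x y} → 0# ≤ z → x ≤ y → z * x ≤ z * y
  *-monoʳ-≤ {z} {x} 0≤z x≤y with ≤⇒+ x≤y
  ... | e , 0≤e , x+e≈y = ≤-cong refl
    (trans (sym (distribˡ z x e)) (*-congˡ x+e≈y))
    (x≤x+y (z * x) (*-nonneg 0≤z 0≤e))

  *-monoˡ-≤ : ∀ {z x y} → 0# ≤ z → x ≤ y → x * z ≤ y * z
  *-monoˡ-≤ 0≤z x≤y = ≤-cong (*-comm _ _) (*-comm _ _) (*-monoʳ-≤ 0≤z x≤y)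

  0≤x*x : ∀ x → 0# ≤ x * x
  0≤x*x x with total 0# x
  ... | inj₁ 0≤x = *-nonneg 0≤x 0≤x
  ... | inj₂ x≤0 with ≤⇒+ x≤0
  ...   | e , 0≤e , x+e≈0 = ≤-cong refl e*e≈x*x (*-nonneg 0≤e 0≤e)
    where
    null : ∀ y → (x + e) * y ≈ 0#
    null y = trans (*-congʳ x+e≈0) (zeroˡ y)
    e*e≈x*x : e * e ≈ x * x
    e*e≈x*x = trans (trans (sym (+-identityʳ _)) (+-congˡ (sym (null x))))
      (trans (solve 2 (λ x e → e :* e :+ (x :+ e) :* x := x :* x :+ (x :+ e) :* e)
                      refl x e)
        (trans (+-congˡ (null e)) (+-identityʳ _)))

  0≤1 : 0# ≤ 1#
  0≤1 = ≤-cong refl (*-identityˡ 1#) (0≤x*x 1#)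

  ⁻¹-nonneg : ∀ {x} → 0# ≤ x → ¬ (x ≈ 0#) → 0# ≤ x ⁻¹
  ⁻¹-nonneg {x} 0≤x x≉0 with total 0# (x ⁻¹)
  ... | inj₁ 0≤x⁻¹ = 0≤x⁻¹
  ... | inj₂ x⁻¹≤0 = contradiction (antisym 0≤1 1≤0) 0≉1
    where
    1≤0 : 1# ≤ 0#
    1≤0 = ≤-cong (⁻¹-inverseʳ x x≉0) (zeroʳ x) (*-monoʳ-≤ 0≤x x⁻¹≤0)

  x*x≈0⇒x≈0 : ∀ x → x * x ≈ 0# → x ≈ 0#
  x*x≈0⇒x≈0 x x*x≈0 with x ≟ 0#
  ... | yes x≈0 = x≈0
  ... | no  x≉0 = trans (sym (*-identityʳ x))
      (trans (*-congˡ (sym (⁻¹-inverseʳ x x≉0)))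
        (trans (sym (*-assoc x x (x ⁻¹)))
          (trans (*-congʳ x*x≈0) (zeroˡ (x ⁻¹)))))

  *-cancelʳ-≤ : ∀ {x y} w → 0# ≤ w → ¬ (w ≈ 0#) → x * w ≤ y * w → x ≤ y
  *-cancelʳ-≤ w 0≤w w≉0 p =
    ≤-cong (strip _) (strip _) (*-monoˡ-≤ (⁻¹-nonneg 0≤w w≉0) p)
    where
    strip : ∀ z → z * w * w ⁻¹ ≈ z
    strip z = trans (*-assoc z w (w ⁻¹))
      (trans (*-congˡ (⁻¹-inverseʳ w w≉0)) (*-identityʳ z))

  -- Squaring reflects the order on nonnegative elements.
  square-reflects-≤ : ∀ {x y} → 0# ≤ y → x * x ≤ y * y → x ≤ y
  square-reflects-≤ {x} {y} 0≤y x²≤y² with total x y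
  ... | inj₁ x≤y = x≤y
  ... | inj₂ y≤x with ≤⇒+ y≤x
  ...   | e , 0≤e , y+e≈x =
    ≤-reflexive (trans (sym y+e≈x) (trans (+-congˡ e≈0) (+-identityʳ y)))
    where
    expand : x * x ≈ (e * e + (y * e + y * e)) + y * y
    expand = trans (*-cong (sym y+e≈x) (sym y+e≈x))
      (solve 2 (λ y e → (y :+ e) :* (y :+ e)
                     := (e :* e :+ (y :* e :+ y :* e)) :+ y :* y) refl y e)
    0≤ye : 0# ≤ y * e
    0≤ye = *-nonneg 0≤y 0≤e
    e²≤0 : e * e ≤ 0#
    e²≤0 = ≤-trans (x≤x+y (e * e) (+-nonneg 0≤ye 0≤ye))
      (+-cancelʳ-≤ (y * y) (≤-cong expand (sym (+-identityˡ _)) x²≤y²))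
    e≈0 : e ≈ 0#
    e≈0 = x*x≈0⇒x≈0 e (antisym e²≤0 (0≤x*x e))

  rearrange-≤ : ∀ {a b c d} → a ≤ b → c ≤ d → a * d + b * c ≤ a * c + b * d
  rearrange-≤ {a} {b} {c} {d} a≤b c≤d with ≤⇒+ a≤b | ≤⇒+ c≤d
  ... | e , 0≤e , a+e≈b | f , 0≤f , c+f≈d = ≤-cong
    (+-cong (*-congˡ c+f≈d) (*-congʳ a+e≈b))
    (trans (solve 4 (λ a c e f → (a :* (c :+ f) :+ (a :+ e) :* c) :+ e :* f
                              := a :* c :+ (a :+ e) :* (c :+ f)) refl a c e f)
      (+-congˡ (*-cong a+e≈b c+f≈d)))
    (x≤x+y _ (*-nonneg 0≤e 0≤f))

module SquareRoot (R : CompleteOrderedField) where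

  open CompleteOrderedField R
  open Eq using (refl; sym; trans)
  open OrderedFieldProperties R
  open NatSolver commutativeSemiring using (solve; _:+_; _:*_; _:=_)

  Root : Carrier → Carrier → Set
  Root x y = 0# ≤ y × y * y ≈ x

  module _ (x : Carrier) (0≤x : 0# ≤ x) where

    private
      Below : Pred Carrier 0ℓ
      Below y = 0# ≤ y × y * y ≤ x

      c : Carrier
      c = x + 1#

      0≤c : 0# ≤ c
      0≤c = +-nonneg 0≤x 0≤1

      x≤c² : x ≤ c * c
      x≤c² = ≤-cong refl
        (trans (solve 2 (λ x o → x :+ ((x :* x :+ x :* o) :+ o)
                              := x :* x :+ x :* o :+ (x :+ o)) refl x 1#)
          (trans (+-congˡ (sym (*-identityʳ c)))
            (trans (+-congʳ (sym (distribˡ x x 1#)))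
              (trans (+-congˡ (*-comm c 1#)) (sym (distribʳ c x 1#))))))
        (x≤x+y x (+-nonneg (+-nonneg (0≤x*x x) (*-nonneg 0≤x 0≤1)) 0≤1))

      0∈Below : Below 0#
      0∈Below = ≤-refl , ≤-cong (sym (zeroˡ 0#)) refl 0≤x

      Below≤c : IsUpperBound _≤_ Below c
      Below≤c y (_ , y²≤x) = square-reflects-≤ 0≤c (≤-trans y²≤x x≤c²)

      lub = supremum Below (0# , 0∈Below) (c , Below≤c)
      s   = proj₁ lub

      0≤s : 0# ≤ s
      0≤s = proj₁ (proj₂ lub) 0# 0∈Below

      u v t : Carrier
      u = s + c
      v = s * c + x
      -- The Möbius map y ↦ (y c + x) / (y + c) moves y towards √x.
      t = v * u ⁻¹

      1≤u : 1# ≤ u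
      1≤u = ≤-cong refl (solve 3 (λ s x o → o :+ (s :+ x) := s :+ (x :+ o)) refl s x 1#)
              (x≤x+y 1# (+-nonneg 0≤s 0≤x))

      0≤u : 0# ≤ u
      0≤u = ≤-trans 0≤1 1≤u

      u≉0 : ¬ (u ≈ 0#)
      u≉0 u≈0 = 0≉1 (antisym 0≤1 (≤-cong refl u≈0 1≤u))

      0≤t : 0# ≤ t
      0≤t = *-nonneg (+-nonneg (*-nonneg 0≤s 0≤c) 0≤x) (⁻¹-nonneg 0≤u u≉0)

      tu≈v : t * u ≈ v
      tu≈v = trans (*-assoc v (u ⁻¹) u)
        (trans (*-congˡ (trans (*-comm (u ⁻¹) u) (⁻¹-inverseʳ u u≉0)))
          (*-identityʳ v))

      uu≉0 : ¬ (u * u ≈ 0#)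
      uu≉0 uu≈0 = u≉0 (x*x≈0⇒x≈0 u uu≈0)

      ttuu : v * v ≈ t * t * (u * u)
      ttuu = trans (sym (*-cong tu≈v tu≈v))
        (solve 2 (λ t u → (t :* u) :* (t :* u) := t :* t :* (u :* u)) refl t u)

      cross : Carrier
      cross = s * c * x + s * c * x

      vv : (s * s * (c * c) + x * x) + cross ≈ v * v
      vv = solve 3 (λ s c x →
             (s :* s :* (c :* c) :+ x :* x) :+ (s :* c :* x :+ s :* c :* x)
             := (s :* c :+ x) :* (s :* c :+ x)) refl s c x

      xuu : (s * s * x + x * (c * c)) + cross ≈ x * (u * u)
      xuu = solve 3 (λ s c x →
              (s :* s :* x :+ x :* (c :* c)) :+ (s :* c :* x :+ s :* c :* x)
              := x :* ((s :+ c) :* (s :+ c))) refl s c x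

      s²≤x⇒t²≤x : s * s ≤ x → t * t ≤ x
      s²≤x⇒t²≤x s²≤x = *-cancelʳ-≤ (u * u) (0≤x*x u) uu≉0
        (≤-cong (trans vv ttuu) xuu (+-monoˡ-≤ cross
          (rearrange-≤ s²≤x x≤c²)))

      x≤s²⇒x≤t² : x ≤ s * s → x ≤ t * t
      x≤s²⇒x≤t² x≤s² = *-cancelʳ-≤ (u * u) (0≤x*x u) uu≉0
        (≤-cong xuu (trans vv ttuu) (+-monoˡ-≤ cross
          (≤-cong (+-comm _ _) (+-comm _ _) (rearrange-≤ x≤s² x≤c²))))

      su : s * u ≈ s * s + s * c
      su = distribˡ s s c

      s²≈x : s * s ≈ x
      s²≈x with total (s * s) x
      ... | inj₁ s²≤x = antisym s²≤x (+-cancelʳ-≤ (s * c)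
              (≤-cong (trans tu≈v (+-comm _ _)) su (*-monoˡ-≤ 0≤u
                (proj₁ (proj₂ lub) t (0≤t , s²≤x⇒t²≤x s²≤x)))))
      ... | inj₂ x≤s² = antisym (+-cancelʳ-≤ (s * c)
              (≤-cong su (trans tu≈v (+-comm _ _)) (*-monoˡ-≤ 0≤u
                (proj₂ (proj₂ lub) t λ y (_ , y²≤x) →
                  square-reflects-≤ 0≤t (≤-trans y²≤x (x≤s²⇒x≤t² x≤s²)))))) x≤s²

    root : ∃ (Root x)
    root = s , 0≤s , s²≈x

  infix 9 √_

  -- The value at negative arguments is irrelevant and set to 0.
  √_ : Carrier → Carrier
  √ x with 0# ≤? x
  ... | yes 0≤x = proj₁ (root x 0≤x)
  ... | no  _   = 0#

  √-root : ∀ x → 0# ≤ x → Root x (√ x)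
  √-root x 0≤x with 0# ≤? x
  ... | yes p   = proj₂ (root x p)
  ... | no  0≰x = contradiction 0≤x 0≰x

module ClosedForm (R : CompleteOrderedField) where

  open CompleteOrderedField R
  open SquareRoot R public using (√_)
  open Exp semiring public using (_^_)
  open Mult semiring using () renaming (_×_ to _·_)

  fromℕ : ℕ → Carrier
  fromℕ n = n · 1#

  infixl 7 _÷_
  _÷_ : Carrier → Carrier → Carrier
  x ÷ y = x * y ⁻¹

  p′ : ℕ → Carrier
  p′ k = (fromℕ 3 * K - K ^ 2
           + √ (fromℕ 4 * K + K ^ 2 - fromℕ 2 * K ^ 3 + K ^ 4))
         ÷ (fromℕ 4 * K)
    where K = fromℕ k

module Sketching (R : CompleteOrderedField) where

  open CompleteOrderedField R
  open Eq using (refl; sym; trans)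
  open OrderedFieldProperties R
  open ClosedForm R public
  open AddTop _≤_ public using (_≤⁺_)

  wt : ∀ {k} → Vec Sign k → ℕ
  wt = count (Signₚ._≟ Sign.+)

  infixl 7 _⊙_
  _⊙_ : ∀ {k} → Vec Sign k → Vec Sign k → Vec Sign k
  _⊙_ = zipWith Sign._*_

  -- S lists the accepted weights.
  f : List ℕ → ∀ {k} → Vec Sign k → Carrier
  f S x = if does (wt x ∈? S) then 1# else 0#

  ∑ : ∀ {k} → (Vec Sign k → Carrier) → Carrier
  ∑ {ℕ.zero}  g = g []
  ∑ {ℕ.suc k} g = ∑ (λ x → g (Sign.+ ∷ x)) + ∑ (λ x → g (Sign.- ∷ x))

  𝔼 : ∀ {k} → (Vec Sign k → Carrier) → (Vec Sign k → Carrier) → Carrier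
  𝔼 pr g = ∑ λ x → pr x * g x

  record Δ (k : ℕ) : Set where
    field
      prob      : Vec Sign k → Carrier
      nonneg    : ∀ x → 0# ≤ prob x
      total-one : ∑ prob ≈ 1#
      symmetric : ∀ x y → wt x ≡ wt y → prob x ≈ prob y

  open Δ public

  bern : Carrier → Sign → Carrier
  bern p Sign.+ = p
  bern p Sign.- = 1# - p

  bernᵏ : Carrier → ∀ {k} → Vec Sign k → Carrier
  bernᵏ p []      = 1#
  bernᵏ p (s ∷ b) = bern p s * bernᵏ p b

  λₛ : List ℕ → ∀ {k} → Δ k → Carrier → Carrier
  λₛ S D p = 𝔼 (prob D) λ a → 𝔼 (bernᵏ p) λ b → f S (a ⊙ b)

  sign : Sign → Carrier
  sign Sign.+ = 1#
  sign Sign.- = - 1#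

  firstIndex : ∀ k .{{_ : NonZero k}} → Fin k
  firstIndex k = fromℕ< (ℕ.>-nonZero⁻¹ k)

  μ : ∀ {k} .{{_ : NonZero k}} → Δ k → Carrier
  μ {k} D = 𝔼 (prob D) λ b → sign (lookup b (firstIndex k))

  Values : List ℕ → ∀ {k} → Δ k → Pred Carrier 0ℓ
  Values S D r = ∃ λ p → 0# ≤ p × p ≤ 1# × r ≈ λₛ S D p

  ∑-cong : ∀ {k} {g h : Vec Sign k → Carrier} → (∀ x → g x ≈ h x) → ∑ g ≈ ∑ h
  ∑-cong {ℕ.zero}  e = e []
  ∑-cong {ℕ.suc k} e = +-cong (∑-cong λ x → e (Sign.+ ∷ x)) (∑-cong λ x → e (Sign.- ∷ x))

  ∑-mono : ∀ {k} {g h : Vec Sign k → Carrier} → (∀ x → g x ≤ h x) → ∑ g ≤ ∑ h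
  ∑-mono {ℕ.zero}  e = e []
  ∑-mono {ℕ.suc k} e = +-mono-≤ (∑-mono λ x → e (Sign.+ ∷ x)) (∑-mono λ x → e (Sign.- ∷ x))

  ∑-scale : ∀ c {k} (g : Vec Sign k → Carrier) → ∑ (λ x → c * g x) ≈ c * ∑ g
  ∑-scale c {ℕ.zero}  g = refl
  ∑-scale c {ℕ.suc k} g = trans
    (+-cong (∑-scale c λ x → g (Sign.+ ∷ x)) (∑-scale c λ x → g (Sign.- ∷ x)))
    (sym (distribˡ c _ _))

  𝔼≤1 : ∀ {k} {pr g : Vec Sign k → Carrier} →
        (∀ x → 0# ≤ pr x) → ∑ pr ≈ 1# → (∀ x → g x ≤ 1#) → 𝔼 pr g ≤ 1#
  𝔼≤1 {k} {pr} 0≤pr ∑≈1 g≤1 = ≤-cong refl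
    (trans (∑-cong {k} {h = pr} λ x → *-identityʳ (pr x)) ∑≈1)
    (∑-mono λ x → *-monoʳ-≤ (0≤pr x) (g≤1 x))

  bern-total : ∀ p → bern p Sign.+ + bern p Sign.- ≈ 1#
  bern-total p = trans (+-comm p (1# - p))
    (trans (+-assoc 1# (- p) p) (trans (+-congˡ (-‿inverseˡ p)) (+-identityʳ 1#)))

  bernᵏ-total : ∀ p k → ∑ {k} (bernᵏ p) ≈ 1#
  bernᵏ-total p ℕ.zero    = refl
  bernᵏ-total p (ℕ.suc k) = trans
    (+-cong (∑-scale p {k} (bernᵏ p)) (∑-scale (1# - p) {k} (bernᵏ p)))
    (trans (sym (distribʳ _ p (1# - p)))
      (trans (*-cong (bern-total p) (bernᵏ-total p k)) (*-identityˡ 1#)))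

  module _ {p} (0≤p : 0# ≤ p) (p≤1 : p ≤ 1#) where

    bern-nonneg : ∀ s → 0# ≤ bern p s
    bern-nonneg Sign.+ = 0≤p
    bern-nonneg Sign.- = ≤-cong (-‿inverseʳ p) refl (+-monoˡ-≤ (- p) p≤1)

    bernᵏ-nonneg : ∀ {k} (b : Vec Sign k) → 0# ≤ bernᵏ p b
    bernᵏ-nonneg []      = 0≤1
    bernᵏ-nonneg (s ∷ b) = *-nonneg (bern-nonneg s) (bernᵏ-nonneg b)

  f≤1 : ∀ S {k} (x : Vec Sign k) → f S x ≤ 1#
  f≤1 S x with does (wt x ∈? S)
  ... | true  = ≤-refl
  ... | false = 0≤1

  Values≤1 : ∀ S {k} (D : Δ k) → IsUpperBound _≤_ (Values S D) 1#
  Values≤1 S {k} D r (p , 0≤p , p≤1 , r≈λ) = ≤-cong (sym r≈λ) refl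
    (𝔼≤1 (nonneg D) (total-one D) λ a →
      𝔼≤1 (bernᵏ-nonneg 0≤p p≤1) (bernᵏ-total p k) λ b → f≤1 S (a ⊙ b))

  β-supremum : ∀ S {k} (D : Δ k) → ∃ (IsSupremum _≤_ (Values S D))
  β-supremum S D = supremum (Values S D)
    (λₛ S D 0# , 0# , ≤-refl , 0≤1 , refl) (1# , Values≤1 S D)

  β : List ℕ → ∀ {k} → Δ k → Carrier
  β S D = proj₁ (β-supremum S D)

  γ : List ℕ → ∀ {k} → Δ k → Carrier
  γ S D = λₛ S D 1#

  ratio : Carrier → Carrier → Carrier ⁺
  ratio b g = if does (g ≟ 0#) then ⊤⁺ else [ b ÷ g ]

  Ratios : List ℕ → ∀ k .{{_ : NonZero k}} → Pred (Carrier ⁺) 0ℓ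
  Ratios S k r = ∃ λ (D-N : Δ k) → ∃ λ (D-Y : Δ k) →
    μ D-N ≈ μ D-Y × r ≡ ratio (β S D-N) (γ S D-Y)

  -- Some D-Y may be supported away from S, so the infimum is taken in the
  -- field extended by a top element ⊤⁺ = +∞.
  infix 4 α[_,_]≈_
  α[_,_]≈_ : List ℕ → ∀ k .{{_ : NonZero k}} → Carrier ⁺ → Set
  α[ S , k ]≈ a = IsInfimum _≤⁺_ (Ratios S k) a

{-# OPTIONS --safe #-}
module Submission where

open import Defs
open import Algebra.Bundles using (CommutativeRing)
import Algebra.Properties.AbelianGroup as AbelianGroupProperties
import Algebra.Properties.CommutativeSemiring.Exp as CommExp
import Algebra.Properties.Ring as RingProperties
import Algebra.Properties.Semiring.Exp as Exp
import Algebra.Properties.Semiring.Mult as Mult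
import Algebra.Properties.Semiring.Mult.TCOptimised as Mult′
import Algebra.Solver.Ring as RingSolver
open import Algebra.Solver.Ring.AlmostCommutativeRing
  using (fromCommutativeRing; _-Raw-AlmostCommutative⟶_)
open import Algebra.Structures using (IsCommutativeRing)
open import Data.Bool.Base using (if_then_else_; true; false)
open import Data.Integer.Base as ℤ using (ℤ; +_; -[1+_])
import Data.Integer.Properties as ℤₚ
open import Data.List.Base using (List; _∷_; [])
open import Data.List.Relation.Unary.Any using (here)
open import Data.Maybe.Base using (Maybe; just; nothing)
open import Data.Nat.Base as ℕ using (ℕ; NonZero; zero; suc)
open import Data.Nat.Combinatorics
  using (_C_; nCk≡nC[n∸k]; nCn≡1; nCk+nC[k+1]≡[n+1]C[k+1])
open import Data.Nat.DivMod using (_/_; _%_; m≡m%n+[m/n]*n; m*n/n≡m)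
import Data.Nat.Properties as ℕₚ
open import Data.List.Membership.DecPropositional ℕₚ._≟_ using (_∈?_)
open import Data.Product.Base using (∃; _×_; _,_; proj₁; proj₂)
open import Data.Sign.Base as Sign using (Sign)
import Data.Sign.Properties as Signₚ
open import Data.Vec.Base using (Vec; []; _∷_; replicate; count)
open import Level using (0ℓ)
open import Relation.Binary.Bundles using (Poset)
import Relation.Binary.Construct.Add.Supremum.NonStrict as AddTop
open import Relation.Binary.PropositionalEquality.Core as ≡ using (_≡_)
import Relation.Binary.Reasoning.PartialOrder as PosetReasoning
import Relation.Binary.Reasoning.Setoid as SetoidReasoning
open import Relation.Binary.Structures using (IsDecTotalOrder)
open import Relation.Nullary using (¬_; does; yes; no; contradiction)
open import Relation.Nullary.Construct.Add.Supremum using ([_])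
open import Relation.Nullary.Decidable using (dec-true; dec-false)

-- Let k = 2n + 1, q = 1 - p, d = p - q and let s(b) be the sum of the signs of b.  Bernoulli's
-- inequality gives 2 bernᵏ p b ≥ (pq)ⁿ (1 + d s(b)) for every b.  Replacing b by a ⊙ b and
-- averaging over a symmetric D turns this into 2 λ(D,p) ≥ C(k,n+1) (pq)ⁿ (1 + d μ(D)).  On the
-- other hand k (1 + d μ(D)) is the mean of k + d s(a) ≥ 0, which equals k + d on weight n + 1, so
-- k (1 + d μ(D)) ≥ (k + d) γ(D).  At p = p′ the two bounds combine to β(D_N) ≥ α γ(D_Y) whenever
-- μ(D_N) = μ(D_Y).
--
-- Equality holds when D_Y is uniform on weight n + 1 and D_N lives on the two constant vectors:
-- then 2k λ(D_N,p) = C(k,n+1) (pq)ⁿ (k + d), and AM-GM with Bernoulli shows that its maximum over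
-- [0,1] is at its critical point p′.

-- Ring normalisation with integer coefficients, for identities that contain subtraction.

module IntegerSolver {c ℓ} (R : CommutativeRing c ℓ) where

  open CommutativeRing R
  open RingProperties ring using (-‿distribˡ-*; -‿distribʳ-*; -0#≈0#; -‿involutive)
  open AbelianGroupProperties +-abelianGroup using (⁻¹-∙-comm)
  open Mult′ semiring using (1+×; ×-homo-+; ×1-homo-*) renaming (_×_ to _·_)
  open SetoidReasoning setoid

  -- The optimised multiple makes `⟦ + 0 ⟧` and `⟦ + 1 ⟧` reduce to `0#` and `1#`. Hence `:0` and
  -- `:1` denote the ring constants themselves, and `2 :× :1` denotes the same term as `fromℕ 2`.
  ⟦_⟧ : ℤ → Carrier
  ⟦ + n      ⟧ = n · 1#
  ⟦ -[1+ n ] ⟧ = - (suc n · 1#)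

  ⟦⟧-neg : ∀ i → ⟦ ℤ.- i ⟧ ≈ - ⟦ i ⟧
  ⟦⟧-neg (+ zero)  = sym -0#≈0#
  ⟦⟧-neg (+ suc n) = refl
  ⟦⟧-neg -[1+ n ]  = sym (-‿involutive _)

  cancel-suc : ∀ a b → a - b ≈ (1# + a) - (1# + b)
  cancel-suc a b = sym (begin
    (1# + a) - (1# + b)      ≈⟨ +-congˡ (⁻¹-∙-comm 1# b) ⟨
    (1# + a) + (- 1# - b)    ≈⟨ +-congʳ (+-comm 1# a) ⟩
    (a + 1#) + (- 1# - b)    ≈⟨ +-assoc a 1# _ ⟩
    a + (1# + (- 1# - b))    ≈⟨ +-congˡ (+-assoc 1# (- 1#) (- b)) ⟨
    a + ((1# - 1#) - b)      ≈⟨ +-congˡ (+-congʳ (-‿inverseʳ 1#)) ⟩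
    a + (0# - b)             ≈⟨ +-congˡ (+-identityˡ (- b)) ⟩
    a - b                    ∎)

  ⟦⟧-⊖ : ∀ m n → ⟦ m ℤ.⊖ n ⟧ ≈ m · 1# - n · 1#
  ⟦⟧-⊖ m       zero    = sym (trans (+-congˡ -0#≈0#) (+-identityʳ _))
  ⟦⟧-⊖ zero    (suc n) = sym (+-identityˡ _)
  ⟦⟧-⊖ (suc m) (suc n) = begin
    ⟦ suc m ℤ.⊖ suc n ⟧                ≡⟨ ≡.cong ⟦_⟧ (ℤₚ.[1+m]⊖[1+n]≡m⊖n m n) ⟩
    ⟦ m ℤ.⊖ n ⟧                        ≈⟨ ⟦⟧-⊖ m n ⟩
    m · 1# - n · 1#                    ≈⟨ cancel-suc _ _ ⟩
    (1# + m · 1#) - (1# + n · 1#)      ≈⟨ +-cong (1+× m 1#) (-‿cong (1+× n 1#)) ⟨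
    suc m · 1# - suc n · 1#            ∎

  ⟦⟧-+ : ∀ i j → ⟦ i ℤ.+ j ⟧ ≈ ⟦ i ⟧ + ⟦ j ⟧
  ⟦⟧-+ (+ m)    (+ n)    = ×-homo-+ 1# m n
  ⟦⟧-+ (+ m)    -[1+ n ] = ⟦⟧-⊖ m (suc n)
  ⟦⟧-+ -[1+ m ] (+ n)    = trans (⟦⟧-⊖ n (suc m)) (+-comm _ _)
  ⟦⟧-+ -[1+ m ] -[1+ n ] = begin
    - (suc (suc (m ℕ.+ n)) · 1#)       ≡⟨ ≡.cong (λ l → - (suc l · 1#)) (ℕₚ.+-suc m n) ⟨
    - ((suc m ℕ.+ suc n) · 1#)         ≈⟨ -‿cong (×-homo-+ 1# (suc m) (suc n)) ⟩
    - (suc m · 1# + suc n · 1#)        ≈⟨ ⁻¹-∙-comm _ _ ⟨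
    - (suc m · 1#) - suc n · 1#        ∎

  ⟦⟧-*⁺ : ∀ m n → ⟦ + m ℤ.* + n ⟧ ≈ m · 1# * n · 1#
  ⟦⟧-*⁺ m n = trans (reflexive (≡.cong ⟦_⟧ (≡.sym (ℤₚ.pos-* m n)))) (×1-homo-* m n)

  ⟦⟧-* : ∀ i j → ⟦ i ℤ.* j ⟧ ≈ ⟦ i ⟧ * ⟦ j ⟧
  ⟦⟧-* (+ m) (+ n) = ⟦⟧-*⁺ m n
  ⟦⟧-* (+ m) -[1+ n ] = begin
    ⟦ + m ℤ.* -[1+ n ] ⟧           ≡⟨ ≡.cong ⟦_⟧ (ℤₚ.neg-distribʳ-* (+ m) (+ suc n)) ⟨
    ⟦ ℤ.- (+ m ℤ.* + suc n) ⟧      ≈⟨ ⟦⟧-neg (+ m ℤ.* + suc n) ⟩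
    - ⟦ + m ℤ.* + suc n ⟧          ≈⟨ -‿cong (⟦⟧-*⁺ m (suc n)) ⟩
    - (m · 1# * suc n · 1#)        ≈⟨ -‿distribʳ-* _ _ ⟩
    m · 1# * (- (suc n · 1#))      ∎
  ⟦⟧-* -[1+ m ] (+ n) = begin
    ⟦ -[1+ m ] ℤ.* + n ⟧           ≡⟨ ≡.cong ⟦_⟧ (ℤₚ.neg-distribˡ-* (+ suc m) (+ n)) ⟨
    ⟦ ℤ.- (+ suc m ℤ.* + n) ⟧      ≈⟨ ⟦⟧-neg (+ suc m ℤ.* + n) ⟩
    - ⟦ + suc m ℤ.* + n ⟧          ≈⟨ -‿cong (⟦⟧-*⁺ (suc m) n) ⟩
    - (suc m · 1# * n · 1#)        ≈⟨ -‿distribˡ-* _ _ ⟩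
    - (suc m · 1#) * n · 1#        ∎
  ⟦⟧-* -[1+ m ] -[1+ n ] = begin
    ⟦ + suc m ℤ.* + suc n ⟧                ≈⟨ ⟦⟧-*⁺ (suc m) (suc n) ⟩
    suc m · 1# * suc n · 1#                ≈⟨ -‿involutive _ ⟨
    - - (suc m · 1# * suc n · 1#)          ≈⟨ -‿cong (-‿distribʳ-* _ _) ⟩
    - (suc m · 1# * (- (suc n · 1#)))      ≈⟨ -‿distribˡ-* _ _ ⟩
    - (suc m · 1#) * (- (suc n · 1#))      ∎

  morphism : ℤ.+-*-rawRing -Raw-AlmostCommutative⟶ fromCommutativeRing R
  morphism = record
    { ⟦_⟧ = ⟦_⟧ ; +-homo = ⟦⟧-+ ; *-homo = ⟦⟧-* ; -‿homo = ⟦⟧-neg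
    ; 0-homo = refl ; 1-homo = refl }

  _coeff≟_ : ∀ i j → Maybe (⟦ i ⟧ ≈ ⟦ j ⟧)
  i coeff≟ j with i ℤₚ.≟ j
  ... | yes i≡j = just (reflexive (≡.cong ⟦_⟧ i≡j))
  ... | no  _   = nothing

  open RingSolver ℤ.+-*-rawRing (fromCommutativeRing R) morphism _coeff≟_ public
    using (Polynomial; solve; _:=_; con; _:+_; _:*_; _:-_; _:×_; :-_)

  :0 :1 : ∀ {n} → Polynomial n
  :0 = con (+ 0)
  :1 = con (+ 1)

-- Ordered-field algebra and the lower bound on Bernoulli monomials.

orderedPoset : CompleteOrderedField → Poset 0ℓ 0ℓ 0ℓ
orderedPoset R = record { isPartialOrder = IsDecTotalOrder.isPartialOrder isDecTotalOrder }
  where open CompleteOrderedField R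

module Inequalities (R : CompleteOrderedField) where

  open CompleteOrderedField R
  open Eq using (refl; sym; trans)
  open IsCommutativeRing isCommutativeRing using (-‿cong)
  open OrderedFieldProperties R
  open SquareRoot R using (√-root)
  open ClosedForm R
  open IntegerSolver commutativeRing using (solve; _:=_; _:+_; _:*_; _:-_; _:×_; :0; :1)
  open Exp semiring using (^-homo-*; ^-congˡ)
  open CommExp commutativeSemiring using (^-distrib-*)
  open Mult semiring using (×-homo-+)
  open PosetReasoning (orderedPoset R)

  fromℕ-+ : ∀ m n → fromℕ (m ℕ.+ n) ≈ fromℕ m + fromℕ n
  fromℕ-+ = ×-homo-+ 1#

  0≤fromℕ : ∀ n → 0# ≤ fromℕ n
  0≤fromℕ zero    = ≤-refl
  0≤fromℕ (suc n) = +-nonneg 0≤1 (0≤fromℕ n)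

  fromℕ-suc≉0 : ∀ n → ¬ (fromℕ (suc n) ≈ 0#)
  fromℕ-suc≉0 n 1+n≈0 =
    0≉1 (antisym 0≤1 (≤-cong refl 1+n≈0 (x≤x+y 1# (0≤fromℕ n))))

  ≤-by : ∀ {x y} e → 0# ≤ e → x + e ≈ y → x ≤ y
  ≤-by {x} e 0≤e x+e≈y = ≤-cong refl x+e≈y (x≤x+y x 0≤e)

  0≤y-x : ∀ {x y} → x ≤ y → 0# ≤ y - x
  0≤y-x {x} x≤y = ≤-cong (-‿inverseʳ x) refl (+-monoˡ-≤ (- x) x≤y)

  -- Serves to prove an equation that holds only modulo a known `a ≈ b`: once the two sides of that
  -- equation are added, what remains is essentially an identity of polynomials.
  +-cancelʳ-≈ : ∀ {x y a b} → a ≈ b → x + a ≈ y + b → x ≈ y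
  +-cancelʳ-≈ {x} {y} {a} {b} a≈b e = antisym
    (+-cancelʳ-≤ a (≤-reflexive (trans e (+-congˡ (sym a≈b)))))
    (+-cancelʳ-≤ a (≤-reflexive (sym (trans e (+-congˡ (sym a≈b))))))

  *-cancelʳ-≈ : ∀ {x y} w → 0# ≤ w → ¬ (w ≈ 0#) → x * w ≈ y * w → x ≈ y
  *-cancelʳ-≈ w 0≤w w≉0 e = antisym
    (*-cancelʳ-≤ w 0≤w w≉0 (≤-reflexive e))
    (*-cancelʳ-≤ w 0≤w w≉0 (≤-reflexive (sym e)))

  *≉0 : ∀ {x y} → ¬ (x ≈ 0#) → ¬ (y ≈ 0#) → ¬ (x * y ≈ 0#)
  *≉0 {x} {y} x≉0 y≉0 xy≈0 = y≉0 (begin-equality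
    y                  ≈⟨ *-identityʳ y ⟨
    y * 1#             ≈⟨ *-congˡ (⁻¹-inverseʳ x x≉0) ⟨
    y * (x * x ⁻¹)     ≈⟨ solve 3 (λ x y z → y :* (x :* z) := (x :* y) :* z) refl x y (x ⁻¹) ⟩
    x * y * x ⁻¹       ≈⟨ *-congʳ xy≈0 ⟩
    0# * x ⁻¹          ≈⟨ zeroˡ _ ⟩
    0#                 ∎)

  ÷-* : ∀ x {y} → ¬ (y ≈ 0#) → x ÷ y * y ≈ x
  ÷-* x {y} y≉0 = begin-equality
    x * y ⁻¹ * y       ≈⟨ solve 3 (λ x y z → x :* z :* y := x :* (y :* z)) refl x y (y ⁻¹) ⟩
    x * (y * y ⁻¹)     ≈⟨ *-congˡ (⁻¹-inverseʳ y y≉0) ⟩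
    x * 1#             ≈⟨ *-identityʳ x ⟩
    x                  ∎

  ^-nonneg : ∀ {x} → 0# ≤ x → ∀ n → 0# ≤ x ^ n
  ^-nonneg 0≤x zero    = 0≤1
  ^-nonneg 0≤x (suc n) = *-nonneg 0≤x (^-nonneg 0≤x n)

  ^-mono-≤ : ∀ {x y} → 0# ≤ x → x ≤ y → ∀ n → x ^ n ≤ y ^ n
  ^-mono-≤ 0≤x x≤y zero    = ≤-refl
  ^-mono-≤ 0≤x x≤y (suc n) = ≤-trans
    (*-monoˡ-≤ (^-nonneg 0≤x n) x≤y)
    (*-monoʳ-≤ (≤-trans 0≤x x≤y) (^-mono-≤ 0≤x x≤y n))

  1^n≈1 : ∀ n → 1# ^ n ≈ 1#
  1^n≈1 zero    = refl
  1^n≈1 (suc n) = trans (*-identityˡ _) (1^n≈1 n)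

  -- Bernoulli's inequality r^(1+e) ≥ r + e (r − 1) for r = p/q, cleared of denominators.
  bernoulli : ∀ {p q} → 0# ≤ p → 0# ≤ q → ∀ e →
              q ^ e * (p + fromℕ e * (p - q)) ≤ p ^ suc e
  bernoulli {p} {q} 0≤p 0≤q zero = ≤-reflexive
    (solve 2 (λ p q → :1 :* (p :+ :0 :* (p :- q)) := p :* :1) refl p q)
  bernoulli {p} {q} 0≤p 0≤q (suc e) = ≤-trans
    (≤-by (q ^ e * (fromℕ (suc e) * ((p - q) * (p - q))))
      (*-nonneg (^-nonneg 0≤q e) (*-nonneg (0≤fromℕ (suc e)) (0≤x*x (p - q))))
      (solve 4 (λ p q r e →
        q :* r :* (p :+ (:1 :+ e) :* (p :- q)) :+ r :* ((:1 :+ e) :* ((p :- q) :* (p :- q)))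
        := p :* (r :* (p :+ e :* (p :- q)))) refl p q (q ^ e) (fromℕ e)))
    (*-monoʳ-≤ 0≤p (bernoulli 0≤p 0≤q e))

  module _ {p q} (0≤p : 0# ≤ p) (0≤q : 0# ≤ q) (p+q≈1 : p + q ≈ 1#) where

    -- With n = l + e and j = l + 2e + 1, the relation p + q = 1 turns 1 + (p - q)(j - l) into 2 (p
    -- + e (p - q)). The claim is then Bernoulli's inequality with exponent 1 + e, multiplied by pⁿ
    -- qˡ and doubled.
    balanced-bound : ∀ e l →
      p ^ (l ℕ.+ e) * q ^ (l ℕ.+ e) *
        (1# + (p - q) * (fromℕ ((l ℕ.+ e) ℕ.+ suc e) - fromℕ l))
      ≤ p ^ ((l ℕ.+ e) ℕ.+ suc e) * q ^ l + p ^ ((l ℕ.+ e) ℕ.+ suc e) * q ^ l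
    balanced-bound e l = begin
      X * q ^ (l ℕ.+ e) * (1# + (p - q) * (fromℕ ((l ℕ.+ e) ℕ.+ suc e) - L))
        ≈⟨ *-cong (*-congˡ (^-homo-* q l e))
             (+-cong (sym p+q≈1) (*-congˡ (+-congʳ
               (trans (fromℕ-+ (l ℕ.+ e) (suc e)) (+-congʳ (fromℕ-+ l e)))))) ⟩
      X * (q ^ l * q ^ e) * ((p + q) + (p - q) * (((L + E) + (1# + E)) - L))
        ≈⟨ solve 7 (λ x y z p q l e →
             x :* (y :* z) :* ((p :+ q) :+ (p :- q) :* (((l :+ e) :+ (:1 :+ e)) :- l))
             := x :* y :* (z :* (p :+ e :* (p :- q))) :+ x :* y :* (z :* (p :+ e :* (p :- q))))
             refl X (q ^ l) (q ^ e) p q L E ⟩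
      X * q ^ l * (q ^ e * (p + E * (p - q))) + X * q ^ l * (q ^ e * (p + E * (p - q)))
        ≤⟨ +-mono-≤ step step ⟩
      X * q ^ l * p ^ suc e + X * q ^ l * p ^ suc e
        ≈⟨ +-cong regroup regroup ⟩
      p ^ ((l ℕ.+ e) ℕ.+ suc e) * q ^ l + p ^ ((l ℕ.+ e) ℕ.+ suc e) * q ^ l ∎
      where
      X = p ^ (l ℕ.+ e)
      L = fromℕ l
      E = fromℕ e
      step = *-monoʳ-≤ (*-nonneg (^-nonneg 0≤p (l ℕ.+ e)) (^-nonneg 0≤q l))
                       (bernoulli 0≤p 0≤q e)
      regroup : X * q ^ l * p ^ suc e ≈ p ^ ((l ℕ.+ e) ℕ.+ suc e) * q ^ l
      regroup = trans
        (solve 3 (λ x y z → x :* y :* z := (x :* z) :* y) refl X (q ^ l) (p ^ suc e))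
        (*-congʳ (sym (^-homo-* p (l ℕ.+ e) (suc e))))

  -- Here `e` measures how far the split of 2n + 1 into j and l is from the balanced one, n + 1 and
  -- n. Both equations have a variable on the left, so matching on them gives the exponents the form
  -- that `balanced-bound` expects.
  excess : ∀ n j l → j ℕ.+ l ≡ suc (n ℕ.+ n) → l ℕ.≤ n →
           ∃ λ e → n ≡ l ℕ.+ e × j ≡ (l ℕ.+ e) ℕ.+ suc e
  excess n j l j+l≡ l≤n with ℕₚ.m≤n⇒∃[o]m+o≡n l≤n
  ... | e , ≡.refl = e , ≡.refl , ℕₚ.+-cancelʳ-≡ l _ _ (≡.trans j+l≡ rearrange)
    where
    rearrange : suc ((l ℕ.+ e) ℕ.+ (l ℕ.+ e)) ≡ ((l ℕ.+ e) ℕ.+ suc e) ℕ.+ l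
    rearrange = ≡.trans (≡.sym (ℕₚ.+-suc (l ℕ.+ e) (l ℕ.+ e)))
      (≡.trans (≡.cong ((l ℕ.+ e) ℕ.+_)
        (≡.trans (≡.sym (ℕₚ.+-suc l e)) (ℕₚ.+-comm l (suc e))))
      (≡.sym (ℕₚ.+-assoc (l ℕ.+ e) (suc e) l)))

  monomial-bound : ∀ {p q} → 0# ≤ p → 0# ≤ q → p + q ≈ 1# →
    ∀ n j l → j ℕ.+ l ≡ suc (n ℕ.+ n) →
    p ^ n * q ^ n * (1# + (p - q) * (fromℕ j - fromℕ l)) ≤ p ^ j * q ^ l + p ^ j * q ^ l
  monomial-bound {p} {q} 0≤p 0≤q p+q≈1 n j l j+l≡ with l ℕₚ.≤? n
  ... | yes l≤n with excess n j l j+l≡ l≤n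
  ...   | e , ≡.refl , ≡.refl = balanced-bound 0≤p 0≤q p+q≈1 e l
  -- If l > n then j ≤ n, and both sides are unchanged when (p, j) and (q, l) are exchanged.
  monomial-bound {p} {q} 0≤p 0≤q p+q≈1 n j l j+l≡ | no l≰n
    with excess n l j (≡.trans (ℕₚ.+-comm l j) j+l≡)
           (ℕₚ.+-cancelʳ-≤ (suc n) j n (ℕₚ.≤-trans (ℕₚ.+-monoʳ-≤ j (ℕₚ.≰⇒> l≰n))
             (ℕₚ.≤-reflexive (≡.trans j+l≡ (≡.sym (ℕₚ.+-suc n n))))))
  ...   | e , ≡.refl , ≡.refl = ≤-cong
          (solve 6 (λ p q x y j l → y :* x :* (:1 :+ (q :- p) :* (l :- j))
                                 := x :* y :* (:1 :+ (p :- q) :* (j :- l)))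
            refl p q (p ^ (j ℕ.+ e)) (q ^ (j ℕ.+ e)) (fromℕ j) (fromℕ ((j ℕ.+ e) ℕ.+ suc e)))
          (+-cong (*-comm _ _) (*-comm _ _))
          (balanced-bound 0≤q 0≤p (trans (+-comm q p) p+q≈1) e j)

  -- Maximisation of (p (1 - p))ⁿ (2n + 1 + p - (1 - p)) over the unit interval.

  amgm : ∀ x y h → h + h ≈ 1# → x * y ≤ (x + y) * h * ((x + y) * h)
  -- The slack is the square of (x - y)/2. Since `h` only stands for one half through `h+h≈1`, x y
  -- is scaled by (h + h)² before the solver applies.
  amgm x y h h+h≈1 = ≤-by ((x - y) * h * ((x - y) * h)) (0≤x*x ((x - y) * h)) (begin-equality
    x * y + (x - y) * h * ((x - y) * h)
      ≈⟨ +-congʳ (trans (sym (*-identityʳ _)) (*-congˡ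
           (trans (sym (*-identityˡ _)) (sym (*-cong h+h≈1 h+h≈1))))) ⟩
    x * y * ((h + h) * (h + h)) + (x - y) * h * ((x - y) * h)
      ≈⟨ solve 3 (λ x y h →
           x :* y :* ((h :+ h) :* (h :+ h)) :+ (x :- y) :* h :* ((x :- y) :* h)
           := (x :+ y) :* h :* ((x :+ y) :* h)) refl x y h ⟩
    (x + y) * h * ((x + y) * h) ∎)

  ^-square : ∀ w n → (w * w) ^ n ≈ w ^ (n ℕ.+ n)
  ^-square w n = trans (^-distrib-* w w n) (sym (^-homo-* w n n))

  half : ∃ λ h → h + h ≈ 1#
  half = fromℕ 2 ⁻¹ , trans
    (solve 1 (λ h → h :+ h := (2 :× :1) :* h) refl (fromℕ 2 ⁻¹))
    (⁻¹-inverseʳ (fromℕ 2) (fromℕ-suc≉0 1))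

  -- The hypothesis critical says that the derivative of
  -- p ↦ (p (1 - p))ⁿ (2n + 1 + (p - (1 - p))) vanishes at P.
  module Optimum (n : ℕ) (P : Carrier)
    (0≤P : 0# ≤ P) (0≤Q : 0# ≤ 1# - P) (P≉0 : ¬ (P ≈ 0#)) (Q≉0 : ¬ (1# - P ≈ 0#))
    (critical : fromℕ (n ℕ.+ n) * (fromℕ (suc (n ℕ.+ n)) + (P - (1# - P))) * (P - (1# - P))
                ≈ fromℕ 4 * (P * (1# - P)))
    where

    private
      Q M E : Carrier
      Q = 1# - P
      M = fromℕ (n ℕ.+ n)
      E = (1# + M) + (P - Q)

    offset-nonneg : ∀ {p} → 0# ≤ p → 0# ≤ (1# + M) + (p - (1# - p))
    offset-nonneg {p} 0≤p = ≤-cong refl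
      (solve 2 (λ m p → m :+ (p :+ p) := (:1 :+ m) :+ (p :- (:1 :- p))) refl M p)
      (+-nonneg (0≤fromℕ (n ℕ.+ n)) (+-nonneg 0≤p 0≤p))

    -- With x = p/P, y = q/Q and w = (x+y)/2 the criticality of P turns the linear factor into
    -- E (1 + 2n (1 - w)), so that AM-GM and Bernoulli give w²ⁿ (1 + 2n (1 - w)) ≤ 1.
    module _ (p : Carrier) (0≤p : 0# ≤ p) (0≤q : 0# ≤ 1# - p) where

      private
        q x y h w : Carrier
        q = 1# - p
        x = p ÷ P
        y = q ÷ Q
        h = proj₁ half
        w = (x + y) * h

      xP≈p : x * P ≈ p
      xP≈p = ÷-* p P≉0

      yQ≈q : y * Q ≈ q
      yQ≈q = ÷-* q Q≉0

      0≤x : 0# ≤ x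
      0≤x = *-nonneg 0≤p (⁻¹-nonneg 0≤P P≉0)

      0≤y : 0# ≤ y
      0≤y = *-nonneg 0≤q (⁻¹-nonneg 0≤Q Q≉0)

      0≤w : 0# ≤ w
      0≤w = *-nonneg (+-nonneg 0≤x 0≤y) (⁻¹-nonneg (0≤fromℕ 2) (fromℕ-suc≉0 1))

      w+w≈x+y : w + w ≈ x + y
      w+w≈x+y = trans (sym (distribˡ (x + y) h h))
        (trans (*-congˡ (proj₂ half)) (*-identityʳ _))

      -- Scaling by `P * Q` removes the divisions in `x` and `y`; then P + Q = p + q = 1 makes the
      -- deviation of x + y from 2 proportional to P - p. The other factor, Q - P, is up to sign the
      -- one that occurs in `critical`.
      deficit : ((1# + 1#) - (x + y)) * (P * Q) ≈ (P - p) * (Q - P)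
      deficit = begin-equality
        ((1# + 1#) - (x + y)) * (P * Q)
          ≈⟨ solve 3 (λ x y P → let Q = :1 :- P in
               ((:1 :+ :1) :- (x :+ y)) :* (P :* Q)
               := P :* Q :+ P :* Q :- (x :* P) :* Q :- (y :* Q) :* P) refl x y P ⟩
        P * Q + P * Q - (x * P) * Q - (y * Q) * P
          ≈⟨ +-cong (+-congˡ (-‿cong (*-congʳ xP≈p))) (-‿cong (*-congʳ yQ≈q)) ⟩
        P * Q + P * Q - p * Q - q * P
          ≈⟨ solve 2 (λ p P → let q = :1 :- p ; Q = :1 :- P in
               P :* Q :+ P :* Q :- p :* Q :- q :* P := (P :- p) :* (Q :- P)) refl p P ⟩
        (P - p) * (Q - P) ∎

      factor : (1# + M) + (p - q) ≈ E * (1# + M * (1# - w))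
      -- 2 P Q is the common denominator of w = (p/P + q/Q)/2.
      factor = *-cancelʳ-≈ (fromℕ 2 * (P * Q))
        (*-nonneg (0≤fromℕ 2) (*-nonneg 0≤P 0≤Q))
        (*≉0 (fromℕ-suc≉0 1) (*≉0 P≉0 Q≉0))
        (begin-equality
          ((1# + M) + (p - q)) * (fromℕ 2 * (P * Q))
            ≈⟨ solve 3 (λ m p P → let q = :1 :- p ; Q = :1 :- P in
                 ((:1 :+ m) :+ (p :- q)) :* ((2 :× :1) :* (P :* Q))
                 := ((:1 :+ m) :+ (P :- Q)) :* ((2 :× :1) :* (P :* Q))
                      :+ (p :- P) :* ((4 :× :1) :* (P :* Q))) refl M p P ⟩
          E * (fromℕ 2 * (P * Q)) + (p - P) * (fromℕ 4 * (P * Q))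
            ≈⟨ +-congˡ (*-congˡ (sym critical)) ⟩
          E * (fromℕ 2 * (P * Q)) + (p - P) * (M * E * (P - Q))
            ≈⟨ solve 5 (λ e m p P Q →
                 e :* ((2 :× :1) :* (P :* Q)) :+ (p :- P) :* (m :* e :* (P :- Q))
                 := e :* ((2 :× :1) :* (P :* Q)) :+ m :* e :* ((P :- p) :* (Q :- P)))
                 refl E M p P Q ⟩
          E * (fromℕ 2 * (P * Q)) + M * E * ((P - p) * (Q - P))
            ≈⟨ +-congˡ (*-congˡ (trans (sym deficit)
                 (*-congʳ (+-congˡ (-‿cong (sym w+w≈x+y)))))) ⟩
          E * (fromℕ 2 * (P * Q)) + M * E * (((1# + 1#) - (w + w)) * (P * Q))
            ≈⟨ solve 4 (λ e m w v →
                 e :* ((2 :× :1) :* v) :+ m :* e :* (((:1 :+ :1) :- (w :+ w)) :* v)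
                 := e :* (:1 :+ m :* (:1 :- w)) :* ((2 :× :1) :* v)) refl E M w (P * Q) ⟩
          E * (1# + M * (1# - w)) * (fromℕ 2 * (P * Q)) ∎)

      rescale : p ^ n * q ^ n ≈ P ^ n * Q ^ n * (x * y) ^ n
      rescale = begin-equality
        p ^ n * q ^ n
          ≈⟨ *-cong (^-congˡ n xP≈p) (^-congˡ n yQ≈q) ⟨
        (x * P) ^ n * (y * Q) ^ n
          ≈⟨ *-cong (^-distrib-* x P n) (^-distrib-* y Q n) ⟩
        x ^ n * P ^ n * (y ^ n * Q ^ n)
          ≈⟨ solve 4 (λ a b c d → a :* b :* (c :* d) := b :* d :* (a :* c))
               refl (x ^ n) (P ^ n) (y ^ n) (Q ^ n) ⟩
        P ^ n * Q ^ n * (x ^ n * y ^ n)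
          ≈⟨ *-congˡ (^-distrib-* x y n) ⟨
        P ^ n * Q ^ n * (x * y) ^ n ∎

      0≤PⁿQⁿ : 0# ≤ P ^ n * Q ^ n
      0≤PⁿQⁿ = *-nonneg (^-nonneg 0≤P n) (^-nonneg 0≤Q n)

      maximal : p ^ n * q ^ n * ((1# + M) + (p - q)) ≤ P ^ n * Q ^ n * E
      maximal = begin
        p ^ n * q ^ n * ((1# + M) + (p - q))
          ≈⟨ *-congʳ rescale ⟩
        P ^ n * Q ^ n * (x * y) ^ n * ((1# + M) + (p - q))
          ≤⟨ *-monoˡ-≤ (offset-nonneg 0≤p) (*-monoʳ-≤ 0≤PⁿQⁿ
               (^-mono-≤ (*-nonneg 0≤x 0≤y) (amgm x y h (proj₂ half)) n)) ⟩
        P ^ n * Q ^ n * (w * w) ^ n * ((1# + M) + (p - q))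
          ≈⟨ *-cong (*-congˡ (^-square w n)) factor ⟩
        P ^ n * Q ^ n * w ^ (n ℕ.+ n) * (E * (1# + M * (1# - w)))
          ≈⟨ solve 4 (λ a b c d → a :* b :* (c :* d) := a :* c :* (b :* d))
               refl (P ^ n * Q ^ n) (w ^ (n ℕ.+ n)) E _ ⟩
        P ^ n * Q ^ n * E * (w ^ (n ℕ.+ n) * (1# + M * (1# - w)))
          ≤⟨ *-monoʳ-≤ (*-nonneg 0≤PⁿQⁿ (offset-nonneg 0≤P)) (bernoulli 0≤1 0≤w (n ℕ.+ n)) ⟩
        P ^ n * Q ^ n * E * 1# ^ suc (n ℕ.+ n)
          ≈⟨ trans (*-congˡ (1^n≈1 (suc (n ℕ.+ n)))) (*-identityʳ _) ⟩
        P ^ n * Q ^ n * E ∎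

  -- `p′ k` lies strictly between 0 and 1 and is critical, for k = j + 1.

  module CriticalPoint (j : ℕ) (M≉0 : ¬ (fromℕ j ≈ 0#)) where

    private
      M K P Q D s F : Carrier
      M = fromℕ j
      K = 1# + M
      P = p′ (suc j)
      Q = 1# - P
      D = fromℕ 4 * K + K ^ 2 - fromℕ 2 * K ^ 3 + K ^ 4
      s = √ D
      F = fromℕ 4 * K

    0≤M : 0# ≤ M
    0≤M = 0≤fromℕ j

    0≤K : 0# ≤ K
    0≤K = 0≤fromℕ (suc j)

    0≤F : 0# ≤ F
    0≤F = *-nonneg (0≤fromℕ 4) 0≤K

    F≉0 : ¬ (F ≈ 0#)
    F≉0 = *≉0 (fromℕ-suc≉0 3) (fromℕ-suc≉0 j)

    -- The gap is exactly 4K (K - 1)². It yields both a nonnegative radicand and s ≥ K² - 3K, which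
    -- makes the numerator of `p′` nonnegative.
    below-root : (K * K - fromℕ 3 * K) * (K * K - fromℕ 3 * K) ≤ D
    below-root = ≤-by (F * (M * M)) (*-nonneg 0≤F (0≤x*x M))
      (solve 1 (λ m → let K = :1 :+ m in
        (K :* K :- (3 :× :1) :* K) :* (K :* K :- (3 :× :1) :* K) :+ (4 :× :1) :* K :* (m :* m)
        := (4 :× :1) :* K :+ K :* (K :* :1) :- (2 :× :1) :* (K :* (K :* (K :* :1)))
             :+ K :* (K :* (K :* (K :* :1)))) refl M)

    0≤D : 0# ≤ D
    0≤D = ≤-trans (0≤x*x (K * K - fromℕ 3 * K)) below-root

    0≤s : 0# ≤ s
    0≤s = proj₁ (√-root D 0≤D)

    s²≈D : s * s ≈ D
    s²≈D = proj₂ (√-root D 0≤D)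

    PF : P * F ≈ fromℕ 3 * K - K ^ 2 + s
    PF = ÷-* _ F≉0

    0≤P : 0# ≤ P
    0≤P = *-cancelʳ-≤ F 0≤F F≉0 (≤-cong (sym (zeroˡ F))
      (trans (solve 2 (λ s K → s :- (K :* K :- (3 :× :1) :* K)
                            := (3 :× :1) :* K :- K :* (K :* :1) :+ s) refl s K) (sym PF))
      (0≤y-x (square-reflects-≤ 0≤s (≤-cong refl (sym s²≈D) below-root))))

    -- The gap between the squares is 4K (K - 1)(K + 1). The bound keeps the numerator 3K - K² + s
    -- at most the denominator 4K.
    s≤K+K² : s ≤ K + K * K
    s≤K+K² = square-reflects-≤ (+-nonneg 0≤K (0≤x*x K))
      (≤-by (F * (M * (K + 1#))) (*-nonneg 0≤F (*-nonneg 0≤M (+-nonneg 0≤K 0≤1)))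
        (trans (+-congʳ s²≈D) (solve 1 (λ m → let K = :1 :+ m in
          (4 :× :1) :* K :+ K :* (K :* :1) :- (2 :× :1) :* (K :* (K :* (K :* :1)))
             :+ K :* (K :* (K :* (K :* :1))) :+ (4 :× :1) :* K :* (m :* (K :+ :1))
          := (K :+ K :* K) :* (K :+ K :* K)) refl M)))

    P≤1 : P ≤ 1#
    P≤1 = *-cancelʳ-≤ F 0≤F F≉0 (≤-cong (sym PF)
      (solve 1 (λ K → (3 :× :1) :* K :- K :* (K :* :1) :+ (K :+ K :* K)
                   := :1 :* ((4 :× :1) :* K)) refl K)
      (+-monoʳ-≤ _ s≤K+K²))

    0≤Q : 0# ≤ Q
    0≤Q = 0≤y-x P≤1

    -- The quadratic formula read backwards: after multiplication by `F`, the left side minus the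
    -- right side is t² - D with t = P F + K² - 3K, and the definition of `p′` gives t = s.
    critical : M * (K + (P - Q)) * (P - Q) ≈ fromℕ 4 * (P * Q)
    critical = *-cancelʳ-≈ F 0≤F F≉0 (+-cancelʳ-≈ (sym s²≈D) (begin-equality
      M * (K + (P - Q)) * (P - Q) * F + D
        ≈⟨ solve 2 (λ m P → let K = :1 :+ m ; Q = :1 :- P ; F = (4 :× :1) :* K
                                t = P :* F :+ K :* K :- (3 :× :1) :* K in
             m :* (K :+ (P :- Q)) :* (P :- Q) :* F
               :+ ((4 :× :1) :* K :+ K :* (K :* :1) :- (2 :× :1) :* (K :* (K :* (K :* :1)))
                     :+ K :* (K :* (K :* (K :* :1))))
             := (4 :× :1) :* (P :* Q) :* F :+ t :* t) refl M P ⟩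
      fromℕ 4 * (P * Q) * F + (P * F + K * K - fromℕ 3 * K) * (P * F + K * K - fromℕ 3 * K)
        ≈⟨ +-congˡ (*-cong t≈s t≈s) ⟩
      fromℕ 4 * (P * Q) * F + s * s ∎))
      where
      t≈s : P * F + K * K - fromℕ 3 * K ≈ s
      t≈s = trans (+-congʳ (+-congʳ PF))
        (solve 2 (λ K s → (3 :× :1) :* K :- K :* (K :* :1) :+ s :+ K :* K :- (3 :× :1) :* K := s)
          refl K s)

    -- At P = 0 the equation `critical` collapses to - M² = 0; the identity writes M² as a multiple
    -- of P modulo that equation.
    P≉0 : ¬ (P ≈ 0#)
    P≉0 P≈0 = *≉0 M≉0 M≉0 (trans
      (+-cancelʳ-≈ critical (solve 2 (λ m P → let K = :1 :+ m ; Q = :1 :- P ; two = :1 :+ :1 in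
        m :* m :+ m :* (K :+ (P :- Q)) :* (P :- Q)
        := P :* (two :* m :* m :+ two :* two :* m :* P :- two :* m :- two :* two :* Q)
             :+ (4 :× :1) :* (P :* Q)) refl M P))
      (trans (*-congʳ P≈0) (zeroˡ _)))

    -- At Q = 0 the equation `critical` collapses to M (1 + K) = 0, where 1 + K is
    -- `fromℕ (suc (suc j))`.
    Q≉0 : ¬ (Q ≈ 0#)
    Q≉0 Q≈0 = *≉0 M≉0 (fromℕ-suc≉0 (suc j)) (trans
      (+-cancelʳ-≈ (sym critical) (solve 2 (λ m P → let K = :1 :+ m ; Q = :1 :- P ; two = :1 :+ :1 in
        m :* (:1 :+ K) :+ (4 :× :1) :* (P :* Q)
        := Q :* (two :* two :* P :+ two :* m :+ two :* m :* (two :+ m) :- two :* two :* m :* Q)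
             :+ m :* (K :+ (P :- Q)) :* (P :- Q)) refl M P))
      (trans (*-congʳ Q≈0) (zeroˡ _)))

  p′-maximal : ∀ n k → k ≡ suc (n ℕ.+ n) → ¬ (fromℕ (n ℕ.+ n) ≈ 0#) →
    let P = p′ k
        g = λ p → p ^ n * (1# - p) ^ n * (fromℕ k + (p - (1# - p)))
    in
    0# ≤ P × P ≤ 1# × (∀ p → 0# ≤ p → p ≤ 1# → g p ≤ g P)
  p′-maximal n k ≡.refl M≉0 = 0≤P , P≤1 , λ p 0≤p p≤1 → maximal p 0≤p (0≤y-x p≤1)
    where
    open CriticalPoint (n ℕ.+ n) M≉0
    open Optimum n (p′ k) 0≤P 0≤Q P≉0 Q≉0 critical

-- Positivity of binomial coefficients.

nC0≡1 : ∀ n → n C 0 ≡ 1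
nC0≡1 n = ≡.trans (nCk≡nC[n∸k] {k = 0} {n} ℕ.z≤n) (nCn≡1 n)

k≤n⇒0<nCk : ∀ {n k} → k ℕ.≤ n → 0 ℕ.< n C k
k≤n⇒0<nCk {n}     {zero}  _           = ℕₚ.≤-reflexive (≡.sym (nC0≡1 n))
k≤n⇒0<nCk {suc n} {suc k} (ℕ.s≤s k≤n) =
  ≡.subst (0 ℕ.<_) (nCk+nC[k+1]≡[n+1]C[k+1] n k) (ℕₚ.m≤n⇒m≤n+o (n C suc k) (k≤n⇒0<nCk k≤n))

-- Sums over sign vectors.

module WeightedSums (R : CompleteOrderedField) where

  open CompleteOrderedField R
  open Eq using (refl; sym; trans) renaming (reflexive to ≈-reflexive)
  open OrderedFieldProperties R
  open Sketching R
  open AddTop _≤_ using ([_]; _≤⊤⁺)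
  open Inequalities R
  open IntegerSolver commutativeRing using (solve; _:=_; _:+_; _:*_; _:-_; _:×_; :-_; :0; :1)
  open IsCommutativeRing isCommutativeRing using (-‿cong)
  open PosetReasoning (orderedPoset R)

  cowt : ∀ {k} → Vec Sign k → ℕ
  cowt = count (Signₚ._≟ Sign.-)

  wt+cowt : ∀ {k} (x : Vec Sign k) → wt x ℕ.+ cowt x ≡ k
  wt+cowt []            = ≡.refl
  wt+cowt (Sign.+ ∷ x) = ≡.cong suc (wt+cowt x)
  wt+cowt (Sign.- ∷ x) = ≡.trans (ℕₚ.+-suc (wt x) (cowt x)) (≡.cong suc (wt+cowt x))

  imbalance : ∀ {k} → Vec Sign k → Carrier
  imbalance []      = 0#
  imbalance (s ∷ x) = sign s + imbalance x

  imbalance≈wt-cowt : ∀ {k} (x : Vec Sign k) → imbalance x ≈ fromℕ (wt x) - fromℕ (cowt x)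
  imbalance≈wt-cowt []           = sym (-‿inverseʳ 0#)
  imbalance≈wt-cowt (Sign.+ ∷ x) = trans (+-congˡ (imbalance≈wt-cowt x))
    (sym (+-assoc 1# _ _))
  imbalance≈wt-cowt (Sign.- ∷ x) = trans (+-congˡ (imbalance≈wt-cowt x))
    (solve 2 (λ a b → :- :1 :+ (a :- b) := a :- (:1 :+ b)) refl (fromℕ (wt x)) (fromℕ (cowt x)))

  -- The expression is a sum over the coordinates of 1 + d or 1 - d, according to their signs.
  imbalance-bound : ∀ {d} → 0# ≤ 1# + d → 0# ≤ 1# - d →
                    ∀ {k} (x : Vec Sign k) → 0# ≤ fromℕ k + d * imbalance x
  imbalance-bound {d} 0≤1+d 0≤1-d [] = ≤-reflexive
    (solve 1 (λ d → :0 := :0 :+ d :* :0) refl d)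
  imbalance-bound {d} 0≤1+d 0≤1-d {suc k} (Sign.+ ∷ x) = ≤-cong refl
    (solve 3 (λ d k i → (:1 :+ d) :+ (k :+ d :* i) := :1 :+ k :+ d :* (:1 :+ i))
      refl d (fromℕ k) (imbalance x))
    (+-nonneg 0≤1+d (imbalance-bound 0≤1+d 0≤1-d x))
  imbalance-bound {d} 0≤1+d 0≤1-d {suc k} (Sign.- ∷ x) = ≤-cong refl
    (solve 3 (λ d k i → (:1 :- d) :+ (k :+ d :* i) := :1 :+ k :+ d :* (:- :1 :+ i))
      refl d (fromℕ k) (imbalance x))
    (+-nonneg 0≤1-d (imbalance-bound 0≤1+d 0≤1-d x))

  bernᵏ≈ : ∀ p {k} (b : Vec Sign k) → bernᵏ p b ≈ p ^ wt b * (1# - p) ^ cowt b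
  bernᵏ≈ p []           = sym (*-identityˡ 1#)
  bernᵏ≈ p (Sign.+ ∷ b) = trans (*-congˡ (bernᵏ≈ p b)) (sym (*-assoc p _ _))
  bernᵏ≈ p (Sign.- ∷ b) = trans (*-congˡ (bernᵏ≈ p b))
    (solve 3 (λ q x y → q :* (x :* y) := x :* (q :* y)) refl (1# - p) (p ^ wt b) _)

  bernᵏ-flip : ∀ p {k} (b : Vec Sign k) →
               bernᵏ p (replicate k Sign.- ⊙ b) ≈ p ^ cowt b * (1# - p) ^ wt b
  bernᵏ-flip p []           = sym (*-identityˡ 1#)
  bernᵏ-flip p (Sign.+ ∷ b) = trans (*-congˡ (bernᵏ-flip p b))
    (solve 3 (λ q x y → q :* (x :* y) := x :* (q :* y)) refl (1# - p) (p ^ cowt b) _)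
  bernᵏ-flip p (Sign.- ∷ b) = trans (*-congˡ (bernᵏ-flip p b)) (sym (*-assoc p _ _))

  ⊙-involutive : ∀ {k} (a b : Vec Sign k) → a ⊙ (a ⊙ b) ≡ b
  ⊙-involutive []           []           = ≡.refl
  ⊙-involutive (Sign.+ ∷ a) (s ∷ b)      = ≡.cong (s ∷_) (⊙-involutive a b)
  ⊙-involutive (Sign.- ∷ a) (Sign.+ ∷ b) = ≡.cong (Sign.+ ∷_) (⊙-involutive a b)
  ⊙-involutive (Sign.- ∷ a) (Sign.- ∷ b) = ≡.cong (Sign.- ∷_) (⊙-involutive a b)

  ⊙-identityˡ : ∀ {k} (a : Vec Sign k) → replicate k Sign.+ ⊙ a ≡ a
  ⊙-identityˡ []      = ≡.refl
  ⊙-identityˡ (s ∷ a) = ≡.cong (s ∷_) (⊙-identityˡ a)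

  ⊙-identityʳ : ∀ {k} (a : Vec Sign k) → a ⊙ replicate k Sign.+ ≡ a
  ⊙-identityʳ []      = ≡.refl
  ⊙-identityʳ (s ∷ a) = ≡.cong₂ _∷_ (Signₚ.*-identityʳ s) (⊙-identityʳ a)

  ∑-+ : ∀ {k} (g h : Vec Sign k → Carrier) → ∑ (λ x → g x + h x) ≈ ∑ g + ∑ h
  ∑-+ {zero}  g h = refl
  ∑-+ {suc k} g h = trans (+-cong (∑-+ {k} _ _) (∑-+ {k} _ _))
    (solve 4 (λ a b c d → a :+ b :+ (c :+ d) := a :+ c :+ (b :+ d)) refl _ _ _ _)

  ∑-zero : ∀ {k} {g : Vec Sign k → Carrier} → (∀ x → g x ≈ 0#) → ∑ g ≈ 0#
  ∑-zero {zero}  g≈0 = g≈0 []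
  ∑-zero {suc k} g≈0 = trans
    (+-cong (∑-zero λ x → g≈0 (Sign.+ ∷ x)) (∑-zero λ x → g≈0 (Sign.- ∷ x))) (+-identityˡ 0#)

  ∑-swap : ∀ {k l} (g : Vec Sign k → Vec Sign l → Carrier) →
           ∑ (λ x → ∑ (λ y → g x y)) ≈ ∑ (λ y → ∑ (λ x → g x y))
  ∑-swap {zero}  g = refl
  ∑-swap {suc k} {l} g = trans (+-cong (∑-swap {k} {l} _) (∑-swap {k} {l} _)) (sym (∑-+ {l} _ _))

  -- Multiplication by a permutes the cube: a `-` in a coordinate swaps the two halves of the sum
  -- there.
  ∑-shift : ∀ {k} (a : Vec Sign k) (g : Vec Sign k → Carrier) → ∑ (λ b → g (a ⊙ b)) ≈ ∑ g
  ∑-shift []           g = refl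
  ∑-shift (Sign.+ ∷ a) g = +-cong (∑-shift a _) (∑-shift a _)
  ∑-shift (Sign.- ∷ a) g = trans (+-comm _ _) (+-cong (∑-shift a _) (∑-shift a _))

  f-accept : ∀ {w k} {x : Vec Sign k} → wt x ≡ w → f (w ∷ []) x ≡ 1#
  f-accept {w} {x = x} wt≡w = ≡.cong (λ b → if b then 1# else 0#)
    (dec-true (wt x ∈? (w ∷ [])) (here wt≡w))

  f-reject : ∀ {w k} {x : Vec Sign k} → ¬ (wt x ≡ w) → f (w ∷ []) x ≡ 0#
  f-reject {w} {x = x} wt≢w = ≡.cong (λ b → if b then 1# else 0#)
    (dec-false (wt x ∈? (w ∷ [])) λ { (here wt≡w) → wt≢w wt≡w })

  f-nonneg : ∀ S {k} (x : Vec Sign k) → 0# ≤ f S x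
  f-nonneg S x with does (wt x ∈? S)
  ... | true  = 0≤1
  ... | false = ≤-refl

  f-symmetric : ∀ S {k} (x y : Vec Sign k) → wt x ≡ wt y → f S x ≈ f S y
  f-symmetric S x y wt≡ =
    ≈-reflexive (≡.cong (λ w → if does (w ∈? S) then 1# else 0#) wt≡)

  -- The factor `f (w ∷ [])` vanishes off weight `w`, so facts valid only on accepted vectors can be
  -- used under a sum.
  f-congˡ : ∀ w {k} {g h : Vec Sign k → Carrier} → (∀ x → wt x ≡ w → g x ≈ h x) →
            ∀ x → f (w ∷ []) x * g x ≈ f (w ∷ []) x * h x
  f-congˡ w e x with wt x ℕₚ.≟ w
  ... | yes wt≡w = *-congˡ (e x wt≡w)
  ... | no  wt≢w rewrite f-reject {w} {x = x} wt≢w = trans (zeroˡ _) (sym (zeroˡ _))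

  ∑-f : ∀ k w → ∑ {k} (f (w ∷ [])) ≈ fromℕ (k C w)
  ∑-f zero    zero    = sym (+-identityʳ 1#)
  ∑-f zero    (suc w) = refl
  ∑-f (suc k) zero    = begin-equality
    ∑ {k} (λ x → f (0 ∷ []) (Sign.+ ∷ x)) + ∑ {k} (f (0 ∷ []))
      ≈⟨ +-cong (∑-zero {k} λ x → refl) (∑-f k zero) ⟩
    0# + fromℕ (k C 0)      ≈⟨ +-identityˡ _ ⟩
    fromℕ (k C 0)           ≡⟨ ≡.cong fromℕ (≡.trans (nC0≡1 k) (≡.sym (nC0≡1 (suc k)))) ⟩
    fromℕ (suc k C 0)       ∎
  ∑-f (suc k) (suc w) = begin-equality
    -- Pascal's rule on the first sign: a leading `+` leaves weight `w` to the rest, a leading `-`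
    -- leaves `suc w`, and the weight test reduces accordingly.
    ∑ {k} (f (w ∷ [])) + ∑ {k} (f (suc w ∷ []))  ≈⟨ +-cong (∑-f k w) (∑-f k (suc w)) ⟩
    fromℕ (k C w) + fromℕ (k C suc w)            ≈⟨ fromℕ-+ (k C w) (k C suc w) ⟨
    fromℕ (k C w ℕ.+ k C suc w)                  ≡⟨ ≡.cong fromℕ (nCk+nC[k+1]≡[n+1]C[k+1] k w) ⟩
    fromℕ (suc k C suc w)                        ∎

  ∑-point⁺ : ∀ {k} (g : Vec Sign k → Carrier) →
             ∑ (λ x → f (k ∷ []) x * g x) ≈ g (replicate k Sign.+)
  ∑-point⁺ {zero}  g = *-identityˡ _
  ∑-point⁺ {suc k} g = trans
    (+-cong (∑-point⁺ (λ x → g (Sign.+ ∷ x))) (∑-zero {k} λ x → trans (*-congʳ (vanish x)) (zeroˡ _)))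
    (+-identityʳ _)
    where
    vanish : ∀ x → f (suc k ∷ []) (Sign.- ∷ x) ≈ 0#
    vanish x rewrite f-reject {suc k} {x = Sign.- ∷ x}
      (λ wt≡ → ℕₚ.<⇒≢ (ℕ.s≤s (≡.subst (wt x ℕ.≤_) (wt+cowt x) (ℕₚ.m≤m+n (wt x) (cowt x)))) wt≡) = refl

  ∑-point⁻ : ∀ {k} (g : Vec Sign k → Carrier) →
             ∑ (λ x → f (0 ∷ []) x * g x) ≈ g (replicate k Sign.-)
  ∑-point⁻ {zero}  g = *-identityˡ _
  ∑-point⁻ {suc k} g = trans
    (+-cong (∑-zero {k} λ x → zeroˡ _) (∑-point⁻ (λ x → g (Sign.- ∷ x))))
    (+-identityˡ _)

  𝔼-bern1 : ∀ {k} (g : Vec Sign k → Carrier) → 𝔼 (bernᵏ 1#) g ≈ g (replicate k Sign.+)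
  𝔼-bern1 {zero}  g = *-identityˡ _
  𝔼-bern1 {suc k} g = trans
    (+-cong
      (trans (∑-cong {k} λ x → *-congʳ (*-identityˡ _)) (𝔼-bern1 {k} (λ x → g (Sign.+ ∷ x))))
      (∑-zero {k} λ x → trans (*-congʳ (trans (*-congʳ (-‿inverseʳ 1#)) (zeroˡ _))) (zeroˡ _)))
    (+-identityʳ _)

  -- Symmetric weights and their correlation with a fixed vector.

  Symmetric : ∀ {k} → (Vec Sign k → Carrier) → Set
  Symmetric {k} g = ∀ x y → wt x ≡ wt y → g x ≈ g y

  -- Plays the role of `μ` for a weight function of arbitrary total mass, such as the slices met in
  -- the induction below.
  drift : ∀ {k} → (Vec Sign (suc k) → Carrier) → Carrier
  drift g = ∑ (λ x → g (Sign.+ ∷ x)) - ∑ (λ x → g (Sign.- ∷ x))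

  𝔼-affine : ∀ {k} (g h : Vec Sign k → Carrier) u →
             𝔼 g (λ x → u + h x) ≈ ∑ g * u + 𝔼 g h
  𝔼-affine {k} g h u = trans (∑-cong {k} λ x → distribˡ (g x) u (h x)) (trans (∑-+ {k} _ _)
    (+-congʳ (trans (∑-cong {k} λ x → *-comm (g x) u) (trans (∑-scale u g) (*-comm u _)))))

  -- Symmetry gives every sign of a the same mean, `drift g`, so the mean of the sum of aᵢ cᵢ is
  -- `drift g` times the sum of the cᵢ. The induction fixes the first sign of a, and both slices are
  -- again symmetric.
  correlation : ∀ {k} (g : Vec Sign (suc k) → Carrier) → Symmetric g → ∀ c →
                𝔼 g (λ a → imbalance (a ⊙ c)) ≈ drift g * imbalance c
  correlation {k} g g-sym (s ∷ c) = trans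
    (+-cong (𝔼-affine {k} _ _ (sign s)) (𝔼-affine {k} _ _ (sign (Sign.- Sign.* s))))
    (trans (+-congˡ (+-congʳ (*-congˡ (flipped s)))) (rest k g g-sym c))
    where
    flipped : ∀ s → sign (Sign.- Sign.* s) ≈ - sign s
    flipped Sign.+ = refl
    flipped Sign.- = solve 0 (:1 := :- (:- :1)) refl
    rest : ∀ k (g : Vec Sign (suc k) → Carrier) → Symmetric g → ∀ c →
      (∑ (λ x → g (Sign.+ ∷ x)) * sign s + 𝔼 (λ x → g (Sign.+ ∷ x)) (λ a → imbalance (a ⊙ c)))
      + (∑ (λ x → g (Sign.- ∷ x)) * - sign s + 𝔼 (λ x → g (Sign.- ∷ x)) (λ a → imbalance (a ⊙ c)))
      ≈ drift g * (sign s + imbalance c)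
    rest zero    g g-sym [] = solve 3 (λ a b s →
      (a :* s :+ a :* :0) :+ (b :* (:- s) :+ b :* :0) := (a :- b) :* (s :+ :0))
      refl (g (Sign.+ ∷ [])) (g (Sign.- ∷ [])) (sign s)
    rest (suc k) g g-sym c = trans
      (+-cong
        (+-congˡ (correlation (λ x → g (Sign.+ ∷ x)) (λ x y e → g-sym _ _ (≡.cong suc e)) c))
        (+-congˡ (correlation (λ x → g (Sign.- ∷ x)) (λ x y e → g-sym _ _ e) c)))
      (trans
        -- Let A, B, C, D be the masses of the vectors starting with ++, +-, -+, --. Replacing B by
        -- C in the first slice drift A - B, and C by B in the second one C - D, gives A - C and B -
        -- D, which add up to `drift g`.
        (+-cong (+-congˡ (*-congʳ (+-congˡ (-‿cong mixed)))) (+-congˡ (*-congʳ (+-congʳ (sym mixed)))))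
        (solve 6 (λ a b c d s i →
          ((a :+ b) :* s :+ (a :- c) :* i) :+ ((c :+ d) :* (:- s) :+ (b :- d) :* i)
          := ((a :+ b) :- (c :+ d)) :* (s :+ i)) refl
          (∑ {k} (λ x → g (Sign.+ ∷ Sign.+ ∷ x))) (∑ {k} (λ x → g (Sign.+ ∷ Sign.- ∷ x)))
          (∑ {k} (λ x → g (Sign.- ∷ Sign.+ ∷ x))) (∑ {k} (λ x → g (Sign.- ∷ Sign.- ∷ x)))
          (sign s) (imbalance c)))
      where
      mixed : ∑ {k} (λ x → g (Sign.+ ∷ Sign.- ∷ x)) ≈ ∑ {k} (λ x → g (Sign.- ∷ Sign.+ ∷ x))
      mixed = ∑-cong {k} λ x → g-sym _ _ ≡.refl

  ∑-scaleʳ : ∀ {k} (g : Vec Sign k → Carrier) c → ∑ (λ x → g x * c) ≈ ∑ g * c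
  ∑-scaleʳ g c = trans (∑-cong λ x → *-comm (g x) c) (trans (∑-scale c g) (*-comm c _))

  ∑-nonneg : ∀ {k} {g : Vec Sign k → Carrier} → (∀ x → 0# ≤ g x) → 0# ≤ ∑ g
  ∑-nonneg {zero}  0≤g = 0≤g []
  ∑-nonneg {suc k} 0≤g = +-nonneg
    (∑-nonneg λ x → 0≤g (Sign.+ ∷ x)) (∑-nonneg λ x → 0≤g (Sign.- ∷ x))

  imbalance-ones : ∀ k → imbalance (replicate k Sign.+) ≈ fromℕ k
  imbalance-ones zero    = refl
  imbalance-ones (suc k) = +-congˡ (imbalance-ones k)

  imbalance-minus-ones : ∀ k → imbalance (replicate k Sign.-) ≈ - fromℕ k
  imbalance-minus-ones zero    = solve 0 (:0 := :- :0) refl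
  imbalance-minus-ones (suc k) = trans (+-congˡ (imbalance-minus-ones k))
    (solve 1 (λ k → :- :1 :+ :- k := :- (:1 :+ k)) refl (fromℕ k))

  μ≈drift : ∀ {j} .{{_ : NonZero (suc j)}} (D : Δ (suc j)) → μ D ≈ drift (prob D)
  μ≈drift {j} D = +-cong
    (∑-cong {j} λ x → *-identityʳ _)
    (trans (∑-scaleʳ {j} (λ x → prob D (Sign.- ∷ x)) (- 1#))
      (solve 1 (λ x → x :* :- :1 := :- x) refl (∑ {j} (λ x → prob D (Sign.- ∷ x)))))

  𝔼-correlation : ∀ {k} .{{_ : NonZero k}} (D : Δ k) c →
                  𝔼 (prob D) (λ a → imbalance (a ⊙ c)) ≈ μ D * imbalance c
  𝔼-correlation {zero}  D [] = trans (zeroʳ _) (sym (zeroʳ _))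
  𝔼-correlation {suc j} D c  =
    trans (correlation (prob D) (symmetric D) c) (*-congʳ (sym (μ≈drift D)))

  𝔼-imbalance : ∀ {k} .{{_ : NonZero k}} (D : Δ k) →
                𝔼 (prob D) imbalance ≈ μ D * fromℕ k
  𝔼-imbalance {k} D = begin-equality
    𝔼 (prob D) imbalance
      ≈⟨ ∑-cong {k} (λ a → *-congˡ (≈-reflexive (≡.cong imbalance (⊙-identityʳ a)))) ⟨
    𝔼 (prob D) (λ a → imbalance (a ⊙ replicate k Sign.+))
      ≈⟨ 𝔼-correlation D (replicate k Sign.+) ⟩
    μ D * imbalance (replicate k Sign.+)
      ≈⟨ *-congˡ (imbalance-ones k) ⟩
    μ D * fromℕ k ∎

  𝔼-affine-scale : ∀ {k} (g h : Vec Sign k → Carrier) u d →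
                   𝔼 g (λ x → u + d * h x) ≈ ∑ g * u + d * 𝔼 g h
  𝔼-affine-scale {k} g h u d = trans (𝔼-affine {k} g _ u) (+-congˡ (trans
    (∑-cong {k} λ x → solve 3 (λ a b c → a :* (b :* c) := b :* (a :* c)) refl (g x) d (h x))
    (∑-scale d {k} _)))

  γ≈ : ∀ S {k} (D : Δ k) → γ S D ≈ 𝔼 (prob D) (f S)
  γ≈ S {k} D = ∑-cong {k} λ a → *-congˡ (trans (𝔼-bern1 {k} _)
    (≈-reflexive (≡.cong (f S) (⊙-identityʳ a))))

  λ≤β : ∀ S {k} (D : Δ k) {p} → 0# ≤ p → p ≤ 1# → λₛ S D p ≤ β S D
  λ≤β S D 0≤p p≤1 = proj₁ (proj₂ (β-supremum S D)) _ (_ , 0≤p , p≤1 , refl)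

  β-least : ∀ S {k} (D : Δ k) {b} → (∀ p → 0# ≤ p → p ≤ 1# → λₛ S D p ≤ b) → β S D ≤ b
  β-least S D λ≤b = proj₂ (proj₂ (β-supremum S D)) _
    λ { r (p , 0≤p , p≤1 , r≈λ) → ≤-cong (sym r≈λ) refl (λ≤b p 0≤p p≤1) }

  -- Bounds on λ and γ for acceptance at weight n + 1 out of k = 2n + 1.

  module Threshold (n k : ℕ) .{{_ : NonZero k}} (k≡1+2n : k ≡ suc (n ℕ.+ n)) where

    m : ℕ
    m = suc n

    S : List ℕ
    S = m ∷ []

    N K M C# : Carrier
    N = fromℕ n
    K = fromℕ k
    M = fromℕ (n ℕ.+ n)
    C# = fromℕ (k C m)

    d G : Carrier → Carrier
    d p = p - (1# - p)
    G p = p ^ n * (1# - p) ^ n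

    cowt≡n : ∀ (x : Vec Sign k) → wt x ≡ m → cowt x ≡ n
    cowt≡n x wt≡m = ℕₚ.+-cancelˡ-≡ m _ _ (≡.trans (≡.cong (ℕ._+ cowt x) (≡.sym wt≡m))
      (≡.trans (wt+cowt x) k≡1+2n))

    imbalance≈1 : ∀ (x : Vec Sign k) → wt x ≡ m → imbalance x ≈ 1#
    imbalance≈1 x wt≡m = trans (imbalance≈wt-cowt x) (trans
      (≈-reflexive (≡.cong₂ (λ a b → fromℕ a - fromℕ b) wt≡m (cowt≡n x wt≡m)))
      (solve 1 (λ n → (:1 :+ n) :- n := :1) refl N))

    module _ (D : Δ k) {p} (0≤p : 0# ≤ p) (0≤q : 0# ≤ 1# - p) where

      private
        -- For fixed a, `X a` is the acceptance probability and `Y a` sums the linear factor of its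
        -- lower bound over the accepted c = a ⊙ b. Indexing by c makes the range of the sum
        -- independent of a.
        X Y : Vec Sign k → Carrier
        X a = 𝔼 (bernᵏ p) (λ b → f S (a ⊙ b))
        Y a = 𝔼 (f S) (λ c → 1# + d p * imbalance (a ⊙ c))

      bernᵏ-bound : ∀ (b : Vec Sign k) → G p * (1# + d p * imbalance b) ≤ bernᵏ p b + bernᵏ p b
      bernᵏ-bound b = ≤-cong
        (*-congˡ (+-congˡ (*-congˡ (sym (imbalance≈wt-cowt b)))))
        (sym (+-cong (bernᵏ≈ p b) (bernᵏ≈ p b)))
        (monomial-bound 0≤p 0≤q (bern-total p) n (wt b) (cowt b)
          (≡.trans (wt+cowt b) k≡1+2n))

      GY≤2X : ∀ a → G p * Y a ≤ X a + X a
      GY≤2X a = begin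
        G p * Y a
          ≈⟨ ∑-scale (G p) {k} _ ⟨
        ∑ {k} (λ c → G p * (f S c * (1# + d p * imbalance (a ⊙ c))))
          ≈⟨ ∑-cong {k} (λ c → trans
               (solve 3 (λ x y z → x :* (y :* z) := x :* z :* y) refl (G p) (f S c) _)
               (*-congˡ (≈-reflexive (≡.cong (f S) (≡.sym (⊙-involutive a c)))))) ⟩
        ∑ {k} (λ c → G p * (1# + d p * imbalance (a ⊙ c)) * f S (a ⊙ (a ⊙ c)))
          -- The substitution b = a ⊙ c. Writing `f S c` as `f S (a ⊙ (a ⊙ c))` has made the summand
          -- a function of a ⊙ c.
          ≈⟨ ∑-shift a (λ b → G p * (1# + d p * imbalance b) * f S (a ⊙ b)) ⟩
        ∑ {k} (λ b → G p * (1# + d p * imbalance b) * f S (a ⊙ b))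
          ≤⟨ ∑-mono {k} (λ b → *-monoˡ-≤ (f-nonneg S (a ⊙ b)) (bernᵏ-bound b)) ⟩
        ∑ {k} (λ b → (bernᵏ p b + bernᵏ p b) * f S (a ⊙ b))
          ≈⟨ ∑-cong {k} (λ b → distribʳ _ _ _) ⟩
        ∑ {k} (λ b → bernᵏ p b * f S (a ⊙ b) + bernᵏ p b * f S (a ⊙ b))
          ≈⟨ ∑-+ {k} _ _ ⟩
        X a + X a ∎

      -- Averaging over a first, for each accepted c, replaces s(a ⊙ c) by μ(D) s(c) = μ(D), because
      -- c has n + 1 pluses and n minuses. The accepted vectors, `C#` in number, then all contribute
      -- the same amount.
      𝔼Y : 𝔼 (prob D) Y ≈ C# * (1# + d p * μ D)
      𝔼Y = begin-equality
        𝔼 (prob D) Y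
          ≈⟨ ∑-cong {k} (λ a → sym (∑-scale (prob D a) {k} _)) ⟩
        ∑ {k} (λ a → ∑ {k} (λ c → prob D a * (f S c * (1# + d p * imbalance (a ⊙ c)))))
          ≈⟨ ∑-swap {k} {k} _ ⟩
        ∑ {k} (λ c → ∑ {k} (λ a → prob D a * (f S c * (1# + d p * imbalance (a ⊙ c)))))
          ≈⟨ ∑-cong {k} (λ c → trans
               (∑-cong {k} λ a →
                 solve 3 (λ x y z → x :* (y :* z) := y :* (x :* z)) refl (prob D a) (f S c) _)
               (∑-scale (f S c) {k} _)) ⟩
        𝔼 (f S) (λ c → 𝔼 (prob D) (λ a → 1# + d p * imbalance (a ⊙ c)))
          ≈⟨ ∑-cong {k} (f-congˡ m inner) ⟩
        𝔼 {k} (f S) (λ c → 1# + d p * μ D)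
          ≈⟨ ∑-scaleʳ {k} (f S) _ ⟩
        ∑ {k} (f S) * (1# + d p * μ D)
          ≈⟨ *-congʳ (∑-f k m) ⟩
        C# * (1# + d p * μ D) ∎
        where
        inner : ∀ c → wt c ≡ m →
                𝔼 (prob D) (λ a → 1# + d p * imbalance (a ⊙ c)) ≈ 1# + d p * μ D
        inner c wt≡m = trans (𝔼-affine-scale {k} (prob D) _ 1# (d p)) (+-cong
          (trans (*-identityʳ _) (total-one D))
          (*-congˡ (trans (𝔼-correlation D c) (trans (*-congˡ (imbalance≈1 c wt≡m)) (*-identityʳ _)))))

      λ-lower : C# * (G p * (1# + d p * μ D)) ≤ λₛ S D p + λₛ S D p
      λ-lower = begin
        C# * (G p * (1# + d p * μ D))
          ≈⟨ solve 3 (λ x y z → x :* (y :* z) := y :* (x :* z)) refl C# (G p) _ ⟩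
        G p * (C# * (1# + d p * μ D))
          ≈⟨ *-congˡ 𝔼Y ⟨
        G p * 𝔼 (prob D) Y
          ≈⟨ ∑-scale (G p) {k} _ ⟨
        ∑ {k} (λ a → G p * (prob D a * Y a))
          ≈⟨ ∑-cong {k} (λ a →
               solve 3 (λ x y z → x :* (y :* z) := y :* (x :* z)) refl (G p) (prob D a) (Y a)) ⟩
        ∑ {k} (λ a → prob D a * (G p * Y a))
          ≤⟨ ∑-mono {k} (λ a → *-monoʳ-≤ (nonneg D a) (GY≤2X a)) ⟩
        ∑ {k} (λ a → prob D a * (X a + X a))
          ≈⟨ ∑-cong {k} (λ a → distribˡ _ _ _) ⟩
        ∑ {k} (λ a → prob D a * X a + prob D a * X a)
          ≈⟨ ∑-+ {k} _ _ ⟩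
        λₛ S D p + λₛ S D p ∎

    γ-upper : .{{_ : NonZero k}} (D : Δ k) {e : Carrier} → 0# ≤ 1# + e → 0# ≤ 1# - e →
              γ S D * (K + e) ≤ K * (1# + e * μ D)
    γ-upper D {e} 0≤1+e 0≤1-e = begin
      γ S D * (K + e)
        ≈⟨ *-congʳ (γ≈ S D) ⟩
      𝔼 (prob D) (f S) * (K + e)
        ≈⟨ ∑-scaleʳ {k} _ (K + e) ⟨
      ∑ {k} (λ a → prob D a * f S a * (K + e))
        ≈⟨ ∑-cong {k} (λ a → *-assoc _ _ _) ⟩
      ∑ {k} (λ a → prob D a * (f S a * (K + e)))
        ≤⟨ ∑-mono {k} (λ a → *-monoʳ-≤ (nonneg D a) (pointwise a)) ⟩
      𝔼 (prob D) (λ a → K + e * imbalance a)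
        ≈⟨ 𝔼-affine-scale {k} (prob D) imbalance K e ⟩
      ∑ (prob D) * K + e * 𝔼 (prob D) imbalance
        ≈⟨ +-cong (*-congʳ (total-one D)) (*-congˡ (𝔼-imbalance D)) ⟩
      1# * K + e * (μ D * K)
        ≈⟨ solve 3 (λ k e u → :1 :* k :+ e :* (u :* k) := k :* (:1 :+ e :* u)) refl K e (μ D) ⟩
      K * (1# + e * μ D) ∎
      where
      pointwise : ∀ (a : Vec Sign k) → f S a * (K + e) ≤ K + e * imbalance a
      pointwise a with wt a ℕₚ.≟ m
      ... | yes wt≡m = ≤-reflexive (trans
              (*-congʳ (≈-reflexive (f-accept {m} {x = a} wt≡m)))
              (trans (*-identityˡ _)
                (+-congˡ (trans (sym (*-identityʳ e)) (*-congˡ (sym (imbalance≈1 a wt≡m)))))))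
      -- Rejected vectors contribute 0 on the left, and e between -1 and 1 keeps the right side
      -- nonnegative.
      ... | no wt≢m = ≤-cong
              (sym (trans (*-congʳ (≈-reflexive (f-reject {m} {x = a} wt≢m))) (zeroˡ _))) refl
              (imbalance-bound 0≤1+e 0≤1-e a)

    -- The extremal pair `D-N`, `D-Y`.

    w⁻ w⁺ : Carrier
    -- The masses of the two constant vectors, chosen so that w⁻ + w⁺ = 1 and w⁺ - w⁻ = 1/k, which
    -- is the mean of a sign under the uniform distribution on weight n + 1.
    w⁻ = (K - 1#) ÷ (fromℕ 2 * K)
    w⁺ = (K + 1#) ÷ (fromℕ 2 * K)

    value : Carrier → Carrier
    value p = C# * (w⁻ * (1# - p) ^ m * p ^ n + w⁺ * (1# - p) ^ n * p ^ m)

    K≈1+M : K ≈ 1# + M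
    K≈1+M = ≈-reflexive (≡.cong fromℕ k≡1+2n)

    K≉0 : ¬ (K ≈ 0#)
    K≉0 K≈0 = fromℕ-suc≉0 (n ℕ.+ n) (trans (sym K≈1+M) K≈0)

    0≤2K : 0# ≤ fromℕ 2 * K
    0≤2K = *-nonneg (0≤fromℕ 2) (0≤fromℕ k)

    2K≉0 : ¬ (fromℕ 2 * K ≈ 0#)
    2K≉0 = *≉0 (fromℕ-suc≉0 1) K≉0

    w⁻2K : w⁻ * (fromℕ 2 * K) ≈ K - 1#
    w⁻2K = ÷-* _ 2K≉0

    w⁺2K : w⁺ * (fromℕ 2 * K) ≈ K + 1#
    w⁺2K = ÷-* _ 2K≉0

    -- Since (K - 1)(1 - p) + (K + 1) p = K + d p, this is, up to the constant `C#`, the function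
    -- treated in `p′-maximal`.
    value-2K : ∀ p → value p * (fromℕ 2 * K) ≈ C# * (G p * (K + d p))
    value-2K p = begin-equality
      value p * (fromℕ 2 * K)
        ≈⟨ solve 8 (λ c a b p q x y t →
             c :* (a :* (q :* y) :* x :+ b :* y :* (p :* x)) :* t
             := c :* (x :* y :* ((a :* t) :* q :+ (b :* t) :* p)))
             refl C# w⁻ w⁺ p (1# - p) (p ^ n) ((1# - p) ^ n) (fromℕ 2 * K) ⟩
      C# * (G p * ((w⁻ * (fromℕ 2 * K)) * (1# - p) + (w⁺ * (fromℕ 2 * K)) * p))
        ≈⟨ *-congˡ (*-congˡ (+-cong (*-congʳ w⁻2K) (*-congʳ w⁺2K))) ⟩
      C# * (G p * ((K - 1#) * (1# - p) + (K + 1#) * p))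
        ≈⟨ *-congˡ (*-congˡ (solve 2 (λ k p →
             (k :- :1) :* (:1 :- p) :+ (k :+ :1) :* p := k :+ (p :- (:1 :- p))) refl K p)) ⟩
      C# * (G p * (K + d p)) ∎

    -- The point masses at the constant vectors are written as weight tests for 0 and k, which makes
    -- the symmetry of `D-N` immediate.
    mixture : Vec Sign k → Carrier
    mixture x = w⁻ * f (0 ∷ []) x + w⁺ * f (k ∷ []) x

    𝔼-mixture : ∀ g → 𝔼 mixture g ≈ w⁻ * g (replicate k Sign.-) + w⁺ * g (replicate k Sign.+)
    𝔼-mixture g = begin-equality
      𝔼 mixture g
        ≈⟨ ∑-cong {k} (λ x → solve 5 (λ a b x y g →
             (a :* x :+ b :* y) :* g := a :* (x :* g) :+ b :* (y :* g))
             refl w⁻ w⁺ (f (0 ∷ []) x) (f (k ∷ []) x) (g x)) ⟩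
      ∑ {k} (λ x → w⁻ * (f (0 ∷ []) x * g x) + w⁺ * (f (k ∷ []) x * g x))
        ≈⟨ trans (∑-+ {k} _ _) (+-cong (∑-scale w⁻ {k} _) (∑-scale w⁺ {k} _)) ⟩
      w⁻ * ∑ {k} (λ x → f (0 ∷ []) x * g x) + w⁺ * ∑ {k} (λ x → f (k ∷ []) x * g x)
        ≈⟨ +-cong (*-congˡ (∑-point⁻ {k} g)) (*-congˡ (∑-point⁺ {k} g)) ⟩
      w⁻ * g (replicate k Sign.-) + w⁺ * g (replicate k Sign.+) ∎

    0≤K-1 : 0# ≤ K - 1#
    0≤K-1 = 0≤y-x (≤-cong refl (sym K≈1+M) (x≤x+y 1# (0≤fromℕ (n ℕ.+ n))))

    0≤K+1 : 0# ≤ K + 1#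
    0≤K+1 = +-nonneg (0≤fromℕ k) 0≤1

    D-N : Δ k
    D-N = record
      { prob = mixture
      ; nonneg = λ x → +-nonneg
          (*-nonneg (*-nonneg 0≤K-1 (⁻¹-nonneg 0≤2K 2K≉0)) (f-nonneg (0 ∷ []) x))
          (*-nonneg (*-nonneg 0≤K+1 (⁻¹-nonneg 0≤2K 2K≉0)) (f-nonneg (k ∷ []) x))
      ; total-one = trans (∑-cong {k} λ x → sym (*-identityʳ _)) (trans (𝔼-mixture (λ _ → 1#))
          (*-cancelʳ-≈ (fromℕ 2 * K) 0≤2K 2K≉0 (begin-equality
            (w⁻ * 1# + w⁺ * 1#) * (fromℕ 2 * K)
              ≈⟨ solve 3 (λ a b t → (a :* :1 :+ b :* :1) :* t := a :* t :+ b :* t)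
                   refl w⁻ w⁺ (fromℕ 2 * K) ⟩
            w⁻ * (fromℕ 2 * K) + w⁺ * (fromℕ 2 * K)
              ≈⟨ +-cong w⁻2K w⁺2K ⟩
            (K - 1#) + (K + 1#)
              ≈⟨ solve 1 (λ k → (k :- :1) :+ (k :+ :1) := :1 :* ((2 :× :1) :* k)) refl K ⟩
            1# * (fromℕ 2 * K) ∎)))
      ; symmetric = λ x y wt≡ → +-cong
          (*-congˡ (f-symmetric (0 ∷ []) x y wt≡)) (*-congˡ (f-symmetric (k ∷ []) x y wt≡))
      }

    -- The mean of the imbalance is k μ, so μ can be read off from the two constant vectors, whose
    -- imbalances are -k and k.
    μ-N : μ D-N * K ≈ 1#
    μ-N = *-cancelʳ-≈ (fromℕ 2) (0≤fromℕ 2) (fromℕ-suc≉0 1) (begin-equality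
      μ D-N * K * fromℕ 2
        ≈⟨ *-congʳ (trans (sym (𝔼-imbalance D-N)) (trans (𝔼-mixture imbalance)
             (+-cong (*-congˡ (imbalance-minus-ones k)) (*-congˡ (imbalance-ones k))))) ⟩
      (w⁻ * - K + w⁺ * K) * fromℕ 2
        ≈⟨ solve 4 (λ a b k t → (a :* :- k :+ b :* k) :* t := b :* (t :* k) :- a :* (t :* k))
             refl w⁻ w⁺ K (fromℕ 2) ⟩
      w⁺ * (fromℕ 2 * K) - w⁻ * (fromℕ 2 * K)
        ≈⟨ +-cong w⁺2K (-‿cong w⁻2K) ⟩
      (K + 1#) - (K - 1#)
        ≈⟨ solve 1 (λ k → (k :+ :1) :- (k :- :1) := :1 :* (2 :× :1)) refl K ⟩
      1# * fromℕ 2 ∎)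

    λ-N : ∀ p → λₛ S D-N p ≈ value p
    λ-N p = begin-equality
      λₛ S D-N p
        ≈⟨ 𝔼-mixture (λ a → 𝔼 (bernᵏ p) (λ b → f S (a ⊙ b))) ⟩
      w⁻ * 𝔼 (bernᵏ p) (λ b → f S (replicate k Sign.- ⊙ b))
        + w⁺ * 𝔼 (bernᵏ p) (λ b → f S (replicate k Sign.+ ⊙ b))
        ≈⟨ +-cong (*-congˡ at-minus) (*-congˡ at-plus) ⟩
      w⁻ * (C# * (p ^ n * (1# - p) ^ m)) + w⁺ * (C# * (p ^ m * (1# - p) ^ n))
        ≈⟨ solve 7 (λ c a b x y x′ y′ →
             a :* (c :* (x :* y′)) :+ b :* (c :* (x′ :* y))
             := c :* (a :* y′ :* x :+ b :* y :* x′))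
             refl C# w⁻ w⁺ (p ^ n) ((1# - p) ^ n) (p ^ m) ((1# - p) ^ m) ⟩
      value p ∎
      where
      constant : ∀ g c → (∀ x → wt x ≡ m → g x ≈ c) → 𝔼 {k} g (f S) ≈ C# * c
      constant g c g≈c = trans (∑-cong {k} λ x → *-comm _ _) (trans
        (∑-cong {k} (f-congˡ m g≈c)) (trans (∑-scaleʳ {k} (f S) c) (*-congʳ (∑-f k m))))
      at-plus : 𝔼 (bernᵏ p) (λ b → f S (replicate k Sign.+ ⊙ b)) ≈ C# * (p ^ m * (1# - p) ^ n)
      at-plus = trans
        (∑-cong {k} λ b → *-congˡ (≈-reflexive (≡.cong (f S) (⊙-identityˡ b))))
        (constant (bernᵏ p) _ λ x wt≡m → trans (bernᵏ≈ p x)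
          (≈-reflexive (≡.cong₂ (λ i j → p ^ i * (1# - p) ^ j) wt≡m (cowt≡n x wt≡m))))
      -- Negating b moves the flip from `f` to `bernᵏ`, where it exchanges the exponents of p and 1
      -- - p.
      at-minus : 𝔼 (bernᵏ p) (λ b → f S (replicate k Sign.- ⊙ b)) ≈ C# * (p ^ n * (1# - p) ^ m)
      at-minus = trans
        (sym (∑-shift (replicate k Sign.-) (λ b → bernᵏ p b * f S (replicate k Sign.- ⊙ b))))
        (trans
          (∑-cong {k} λ b → *-congˡ (≈-reflexive
            (≡.cong (f S) (⊙-involutive (replicate k Sign.-) b))))
          (constant (λ b → bernᵏ p (replicate k Sign.- ⊙ b)) _ λ x wt≡m → trans (bernᵏ-flip p x)
            (≈-reflexive (≡.cong₂ (λ i j → p ^ i * (1# - p) ^ j) (cowt≡n x wt≡m) wt≡m))))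

    0≤C# : 0# ≤ C#
    0≤C# = 0≤fromℕ (k C m)

    m≤k : m ℕ.≤ k
    m≤k = ≡.subst (m ℕ.≤_) (≡.sym k≡1+2n) (ℕ.s≤s (ℕₚ.m≤m+n n n))

    C#≉0 : ¬ (C# ≈ 0#)
    C#≉0 with k C m | k≤n⇒0<nCk {k} {m} m≤k
    ... | suc c | _ = fromℕ-suc≉0 c

    D-Y : Δ k
    D-Y = record
      { prob = λ x → f S x * C# ⁻¹
      ; nonneg = λ x → *-nonneg (f-nonneg S x) (⁻¹-nonneg 0≤C# C#≉0)
      ; total-one = trans (∑-scaleʳ {k} (f S) (C# ⁻¹))
          (trans (*-congʳ (∑-f k m)) (⁻¹-inverseʳ C# C#≉0))
      ; symmetric = λ x y wt≡ → *-congʳ (f-symmetric S x y wt≡)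
      }

    -- `D-Y` is supported on weight `m`. Both `imbalance` and `f S` equal 1 there, so this yields
    -- its mean and its γ at once.
    𝔼-Y : ∀ g → (∀ x → wt x ≡ m → g x ≈ 1#) → 𝔼 (prob D-Y) g ≈ 1#
    𝔼-Y g g≈1 = trans
      (∑-cong {k} λ x → trans (*-assoc _ _ _)
        (f-congˡ m (λ x wt≡m → trans (*-congˡ (g≈1 x wt≡m)) (*-identityʳ _)) x))
      (total-one D-Y)

    μ-Y : μ D-Y * K ≈ 1#
    μ-Y = trans (sym (𝔼-imbalance D-Y)) (𝔼-Y imbalance imbalance≈1)

    γ-Y : γ S D-Y ≈ 1#
    γ-Y = trans (γ≈ S D-Y) (𝔼-Y (f S) λ x wt≡m → ≈-reflexive (f-accept {m} {x = x} wt≡m))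

    μ-N≈μ-Y : μ D-N ≈ μ D-Y
    μ-N≈μ-Y = *-cancelʳ-≈ K (0≤fromℕ k) K≉0 (trans μ-N (sym μ-Y))

    0≤γ : ∀ (D : Δ k) → 0# ≤ γ S D
    0≤γ D = ≤-cong refl (sym (γ≈ S D))
      (∑-nonneg {k} λ x → *-nonneg (nonneg D x) (f-nonneg S x))

    -- The infimum is `value (p′ k)` and is attained.

    module _ (M≉0 : ¬ (M ≈ 0#)) where

      private
        P : Carrier
        P = p′ k

        0≤P : 0# ≤ P
        0≤P = proj₁ (p′-maximal n k k≡1+2n M≉0)

        P≤1 : P ≤ 1#
        P≤1 = proj₁ (proj₂ (p′-maximal n k k≡1+2n M≉0))

        0≤Q : 0# ≤ 1# - P
        0≤Q = 0≤y-x P≤1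

      β-N≤value : β S D-N ≤ value P
      β-N≤value = β-least S D-N λ p 0≤p p≤1 → ≤-cong (sym (λ-N p)) refl
        (*-cancelʳ-≤ (fromℕ 2 * K) 0≤2K 2K≉0 (≤-cong (sym (value-2K p)) (sym (value-2K P))
          (*-monoʳ-≤ 0≤C# (proj₂ (proj₂ (p′-maximal n k k≡1+2n M≉0)) p 0≤p p≤1))))

      -- Division-free, because γ(D′) may be 0. The factor K + d P of `value-2K` is the one on the
      -- left of `γ-upper`, and the factor 1 + d P μ left by that bound is the one on the left of
      -- `λ-lower`.
      valueγ≤β : ∀ (D D′ : Δ k) → μ D ≈ μ D′ → value P * γ S D′ ≤ β S D
      valueγ≤β D D′ μ≈ = *-cancelʳ-≤ (fromℕ 2 * K) 0≤2K 2K≉0 (begin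
        value P * γ S D′ * (fromℕ 2 * K)
          ≈⟨ solve 3 (λ v g t → v :* g :* t := v :* t :* g) refl (value P) (γ S D′) _ ⟩
        value P * (fromℕ 2 * K) * γ S D′
          ≈⟨ *-congʳ (value-2K P) ⟩
        C# * (G P * (K + d P)) * γ S D′
          ≈⟨ solve 4 (λ c g e y → c :* (g :* e) :* y := c :* g :* (y :* e))
               refl C# (G P) (K + d P) (γ S D′) ⟩
        C# * G P * (γ S D′ * (K + d P))
          ≤⟨ *-monoʳ-≤ (*-nonneg 0≤C# (*-nonneg (^-nonneg 0≤P n) (^-nonneg 0≤Q n)))
               (γ-upper D′ 0≤1+d 0≤1-d) ⟩
        C# * G P * (K * (1# + d P * μ D′))
          -- Equality of the means links the upper bound for D′ to the lower bound for D.
          ≈⟨ *-congˡ (*-congˡ (+-congˡ (*-congˡ (sym μ≈)))) ⟩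
        C# * G P * (K * (1# + d P * μ D))
          ≈⟨ solve 4 (λ c g k e → c :* g :* (k :* e) := c :* (g :* e) :* k)
               refl C# (G P) K (1# + d P * μ D) ⟩
        C# * (G P * (1# + d P * μ D)) * K
          ≤⟨ *-monoˡ-≤ (0≤fromℕ k) (λ-lower D 0≤P 0≤Q) ⟩
        (λₛ S D P + λₛ S D P) * K
          ≤⟨ *-monoˡ-≤ (0≤fromℕ k) (+-mono-≤ (λ≤β S D 0≤P P≤1) (λ≤β S D 0≤P P≤1)) ⟩
        (β S D + β S D) * K
          ≈⟨ solve 2 (λ b k → (b :+ b) :* k := b :* ((2 :× :1) :* k)) refl (β S D) K ⟩
        β S D * (fromℕ 2 * K) ∎)
        where
        0≤1+d : 0# ≤ 1# + d P
        0≤1+d = ≤-cong refl (solve 1 (λ p → p :+ p := :1 :+ (p :- (:1 :- p))) refl P)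
          (+-nonneg 0≤P 0≤P)
        0≤1-d : 0# ≤ 1# - d P
        0≤1-d = ≤-cong refl
          (solve 1 (λ p → (:1 :- p) :+ (:1 :- p) := :1 :- (p :- (:1 :- p))) refl P)
          (+-nonneg 0≤Q 0≤Q)

      value≤ratio : ∀ a b g → 0# ≤ g → a * g ≤ b → [ a ] ≤⁺ ratio b g
      value≤ratio a b g 0≤g ag≤b with g ≟ 0#
      ... | yes _   = [ a ] ≤⊤⁺
      ... | no  g≉0 = [ *-cancelʳ-≤ g 0≤g g≉0 (≤-cong refl (sym (÷-* b g≉0)) ag≤b) ]

      ratio≤ : ∀ {a b g} → g ≈ 1# → b ≤ a → ratio b g ≤⁺ [ a ]
      ratio≤ {a} {b} {g} g≈1 b≤a with g ≟ 0#
      ... | yes g≈0 = contradiction (trans (sym g≈0) g≈1) 0≉1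
      ... | no  g≉0 = [ ≤-cong (sym (trans (sym (*-identityʳ _))
                          (trans (*-congˡ (sym g≈1)) (÷-* b g≉0)))) refl b≤a ]

      α≈value : α[ S , k ]≈ [ value P ]
      α≈value =
        (λ { _ (D , D′ , μ≈ , ≡.refl) →
             value≤ratio (value P) (β S D) (γ S D′) (0≤γ D′) (valueγ≤β D D′ μ≈) }) ,
        -- The ratio of `D-N` and `D-Y` is at most `value P`, hence so is every lower bound of the
        -- ratios.
        (λ b b≤ → AddTop.≤⁺-trans _≤_ ≤-trans (b≤ _ (D-N , D-Y , μ-N≈μ-Y , ≡.refl))
                    (ratio≤ γ-Y β-N≤value))

-- Parity arithmetic and the closed form.

n+n≡n*2 : ∀ n → n ℕ.+ n ≡ n ℕ.* 2
n+n≡n*2 n = ≡.trans (≡.cong (n ℕ.+_) (≡.sym (ℕₚ.+-identityʳ n))) (ℕₚ.*-comm 2 n)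

odd⇒k≡1+2[k/2] : ∀ k → k % 2 ≡ 1 → k ≡ suc (k / 2 ℕ.+ k / 2)
odd⇒k≡1+2[k/2] k odd =
  ≡.trans (m≡m%n+[m/n]*n k 2) (≡.cong₂ ℕ._+_ odd (≡.sym (n+n≡n*2 (k / 2))))

[k+1]/2≡1+k/2 : ∀ k → k % 2 ≡ 1 → (k ℕ.+ 1) / 2 ≡ suc (k / 2)
[k+1]/2≡1+k/2 k odd = ≡.trans
  (≡.cong (_/ 2) (≡.trans (ℕₚ.+-comm k 1) (≡.cong suc
    (≡.trans (odd⇒k≡1+2[k/2] k odd) (≡.cong suc (n+n≡n*2 (k / 2)))))))
  (m*n/n≡m (suc (k / 2)) 2)

[k∸1]/2≡k/2 : ∀ k → k % 2 ≡ 1 → (k ℕ.∸ 1) / 2 ≡ k / 2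
[k∸1]/2≡k/2 k odd = ≡.trans
  (≡.cong (_/ 2) (≡.trans (≡.cong (ℕ._∸ 1) (odd⇒k≡1+2[k/2] k odd)) (n+n≡n*2 (k / 2))))
  (m*n/n≡m (k / 2) 2)

theorem5p11 :
    (R : CompleteOrderedField) →
    let open CompleteOrderedField R
        open Sketching R
    in
    ∀ (k : ℕ) .{{_ : NonZero k}} → k % 2 ≡ 1 → 3 ℕ.≤ k → k ℕ.≤ 51 →
    let m = (k ℕ.+ 1) / 2
        n = (k ℕ.∸ 1) / 2
        K = fromℕ k
        p = p′ k
    in
    α[ m ∷ [] , k ]≈
      [ fromℕ (k C m) *
        ( (K - 1#) ÷ (fromℕ 2 * K) * (1# - p) ^ m * p ^ n
        + (K + 1#) ÷ (fromℕ 2 * K) * (1# - p) ^ n * p ^ m ) ]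
-- After (k + 1) / 2 and (k ∸ 1) / 2 become `suc (k / 2)` and `k / 2`, the goal is about
-- `value (p′ k)` as it stands.
theorem5p11 R k k%2≡1 3≤k _ rewrite [k+1]/2≡1+k/2 k k%2≡1 | [k∸1]/2≡k/2 k k%2≡1 =
  WeightedSums.Threshold.α≈value R (k / 2) k (odd⇒k≡1+2[k/2] k k%2≡1) M≉0
  where
  open CompleteOrderedField R
  open Sketching R
  M≉0 : ¬ (fromℕ (k / 2 ℕ.+ k / 2) ≈ 0#)
  M≉0 with k / 2 ℕ.+ k / 2 | ≡.subst (3 ℕ.≤_) (odd⇒k≡1+2[k/2] k k%2≡1) 3≤k
  ... | suc j | _       = Inequalities.fromℕ-suc≉0 R j
  -- If 2 (k / 2) were 0, then k would be 1, against 3 ≤ k.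
  ... | zero  | ℕ.s≤s ()
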